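{- Let $k\ge 2$, let $V$ be a finite set with $n:=|V|$, and let $\chi_0,\dots,\chi_\ell\colon V^k\to C$ be colorings such that (I) $\chi_t$ is shufflable and compatible with equality for all $t\in\{0,\dots,\ell\}$; (II) $\chi_t\preceq \chi_{t-1}'$ for all $t\in\{1,\dots,\ell\}$, where $\chi_{t-1}'$ is the $k$-WL refinement of $\chi_{t-1}$; (III) $\chi_t\prec\chi_{t-1}$ for all $t\in\{1,\dots,\ell\}$. Then $\ell\le 2n^{k-1}(\lceil k\log n\rceil+1)=O(kn^{k-1}\log n)$.
   Context: For colorings $\chi_1,\chi_2\colon V^k\to C$: $\chi_1\preceq\chi_2$ ($\chi_1$ refines $\chi_2$) if $\chi_1(\vec v)=\chi_1(\vec w)$ implies $\chi_2(\vec v)=\chi_2(\vec w)$; $\chi_1\equiv\chi_2$ if both $\chi_1\preceq\chi_2$ and $\chi_2\preceq\chi_1$; $\chi_1\prec\chi_2$ if $\chi_1\preceq\chi_2$ and $\chi_1\not\equiv\chi_2$. The $k$-WL refinement of $\chi$ is $\chi'(\vec v)=\big(\chi(\vec v),\{\!\{(\chi(\vec v[w/1]),\dots,\chi(\vec v[w/k]))\mid w\in V\}\!\}\big)$, where $\vec v[w/i]$ is $\vec v$ with its $i$-th entry replaced by $w$. A coloring is compatible with equality if whenever $(v_1,\dots,v_k),(w_1,\dots,w_k)$ have the same color, then for all $i,j\in[k]$: $v_i=v_j\iff w_i=w_j$. A coloring is shufflable if for every function $\pi\colon[k]\to[k]$ (not necessarily bijective) and all tuples of the same color $(v_1,\dots,v_k),(w_1,\dots,w_k)$,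 the tuples $(v_{\pi(1)},\dots,v_{\pi(k)})$ and $(w_{\pi(1)},\dots,w_{\pi(k)})$ also have the same color. $\log$ is base 2. -}

module Defs where

open import Data.Nat using (ℕ)
open import Data.Fin using (Fin)
open import Data.Vec using (Vec; lookup; tabulate; _[_]≔_)
open import Data.List using (List; map)
open import Data.Product using (_×_)
open import Data.List.Relation.Binary.Permutation.Propositional using (_↭_)
open import Relation.Binary.PropositionalEquality using (_≡_)
open import Relation.Nullary using (¬_)
import Data.Fin as F
import Data.List as L

Tuple : ℕ → ℕ → Set
Tuple n k = Vec (Fin n) k

Coloring : ℕ → ℕ → Set → Set
Coloring n k C = Tuple n k → C

module _ {n k : ℕ} {C D : Set} where

  _⪯_ : Coloring n k C → Coloring n k D → Set
  χ₁ ⪯ χ₂ = ∀ v w → χ₁ v ≡ χ₁ w → χ₂ v ≡ χ₂ w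

module _ {n k : ℕ} {C : Set} where

  _≡ᶜ_ : Coloring n k C → Coloring n k C → Set
  χ₁ ≡ᶜ χ₂ = (χ₁ ⪯ χ₂) × (χ₂ ⪯ χ₁)

  _≺_ : Coloring n k C → Coloring n k C → Set
  χ₁ ≺ χ₂ = (χ₁ ⪯ χ₂) × ¬ (χ₁ ≡ᶜ χ₂)

  -- The multiset {{ (χ(v[w/1]),…,χ(v[w/k])) | w ∈ V }}, represented as a
  -- list enumerating w over V; multisets are compared up to permutation.
  wlMultiset : Coloring n k C → Tuple n k → List (Vec C k)
  wlMultiset χ v = L.map (λ w → tabulate (λ i → χ (v [ i ]≔ w))) (L.allFin n)

  -- χ'(v) = χ'(w) for the k-WL refinement χ' of χ:
  -- χ(v) = χ(w) and equal multisets.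
  WLSame : Coloring n k C → Tuple n k → Tuple n k → Set
  WLSame χ v w = (χ v ≡ χ w) × (wlMultiset χ v ↭ wlMultiset χ w)

  RefinesWL : Coloring n k C → Coloring n k C → Set
  RefinesWL χ₁ χ₂ = ∀ v w → χ₁ v ≡ χ₁ w → WLSame χ₂ v w

  CompatibleWithEquality : Coloring n k C → Set
  CompatibleWithEquality χ =
    ∀ v w → χ v ≡ χ w → ∀ (i j : Fin k) →
      ((lookup v i ≡ lookup v j → lookup w i ≡ lookup w j) ×
       (lookup w i ≡ lookup w j → lookup v i ≡ lookup v j))

  shuffle : (Fin k → Fin k) → Tuple n k → Tuple n k
  shuffle π v = tabulate (λ i → lookup v (π i))

  Shufflable : Coloring n k C → Set
  Shufflable χ =
    ∀ (π : Fin k → Fin k) v w → χ v ≡ χ w → χ (shuffle π v) ≡ χ (shuffle π w)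

{-# OPTIONS --safe #-}
-- Write k = m + 2 and split a k-tuple as (x, y, z).  The functions on V^k that are constant on the
-- colour classes of χ_t, read as block-diagonal matrices with entry (x, y) in block z, form a space A_t
-- of N × N matrices, N = n^(k-1), that contains 1, is closed under transposition, and satisfies
-- A_t A_t ⊆ A_{t+1}.  The algebra generated by A_t is spanned by words of length at most n^k, so it lies
-- in A_{t+s-1} for s = ⌈log n^k⌉ + 1.  Hence the algebras generated by A_0, A_s, A_2s, ... increase strictly.
--
-- A strictly increasing chain of unital transpose-closed subalgebras of the N × N matrices over an
-- ordered field has fewer than 2N steps.  Let rank A be the largest dimension of a commutative
-- transpose-closed subspace of A; it is at most N, because such a subspace has a separating vector.  If
-- A ⊊ B, then rank A < rank B or rank A' > rank B' for the commutants (by the double commutant theorem).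
--
-- Equality of colours need not be decidable, but the conclusion is, so all case distinctions take place
-- under a double negation.
module Submission where

open import Defs
open import Algebra.Bundles using (CommutativeRing)
open import Algebra.Structures using (IsCommutativeRing)
open import Data.Empty using (⊥; ⊥-elim)
open import Data.Fin as Fin using (Fin)
open import Data.List using (List; []; _∷_; _++_; length; map; allFin; cartesianProduct; take; drop)
open import Data.List.Membership.Propositional using (_∈_)
open import Data.List.Membership.Propositional.Properties using (∈-allFin; ∈-cartesianProduct⁺; ∈-map⁺)
open import Data.List.Properties using (length-tabulate; length-map; length-++; length-take; length-drop; take++drop≡id; ∷-injective)
open import Data.List.Relation.Binary.Permutation.Propositional as ↭ using (_↭_)
open import Data.List.Relation.Binary.Permutation.Propositional.Properties using (↭-map-inv)
open import Data.List.Relation.Unary.All as All using (All; []; _∷_)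
open import Data.List.Relation.Unary.All.Properties using (++⁺; take⁺; drop⁺)
open import Data.List.Relation.Unary.AllPairs using ([]; _∷_)
open import Data.List.Relation.Unary.Any using (here; there)
open import Data.List.Relation.Unary.Unique.Propositional using (Unique)
import Data.List.Relation.Unary.Unique.Propositional.Properties as Unique
open import Data.Nat as ℕ using (ℕ; zero; suc)
open import Data.Nat.Induction using (<-rec)
open import Data.Nat.Logarithm using (⌈log₂_⌉; ⌈log₂⌉-mono-≤; ⌈log₂⌈n/2⌉⌉≡⌈log₂n⌉∸1)
import Data.Nat.Properties as ℕ
open import Data.Nat.Solver using (module +-*-Solver)
open +-*-Solver using (solve; con; _:+_; _:=_)
open import Data.Product using (_×_; _,_; proj₁; proj₂; ∃; uncurry)
open import Data.Product.Properties using (≡-dec)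
open import Data.Rational using (ℚ; 0ℚ; 1ℚ)
import Data.Rational as ℚ
import Data.Rational.Properties as ℚ
open import Data.Sum using (_⊎_; inj₁; inj₂)
open import Data.Unit using (⊤; tt)
open import Data.Vec as Vec using (Vec; []; _∷_)
import Data.Vec.Properties as Vec
open import Relation.Binary.Definitions using (DecidableEquality)
open import Relation.Binary.PropositionalEquality using (_≡_; refl; sym; trans; cong; cong₂; subst; subst₂; module ≡-Reasoning)
open import Relation.Nullary using (¬_; Dec; yes; no)
open import Relation.Nullary.Decidable using (¬¬-excluded-middle; decidable-stable)

-- Dimensions of the generated algebras can be as large as n^k, so counting them along the chain
-- would lose a factor n. Comparing an algebra and its commutant at once recovers it: one rank can
-- only grow, the other only shrink, and both live on the scale n^(k-1). The obstacle is that ℚ has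
-- neither eigenvalues nor square roots, so commuting matrices cannot be diagonalized and orthogonal
-- vectors cannot be normalised. The linear algebra rests on positivity instead: a sum of squares
-- vanishes only if every square does. This makes the entrywise inner product of matrices definite,
-- with transposition as adjoint, and orthogonality then does the work of diagonalization. The two
-- summands of s have different origins. Repeated multiplication for ⌈log n^k⌉ rounds reaches all
-- words that matter; one further strict refinement then supplies a matrix outside the algebra
-- generated by A_t.

-- Of the order only the cone of nonnegative elements is kept, and it need not be total.
record OrderedField : Set₁ where
  infixl 6 _+_
  infixl 7 _*_
  field
    F : Set
    _+_ _*_ : F → F → F
    -_ _⁻¹ : F → F
    0# 1# : F
    isCommutativeRing : IsCommutativeRing _≡_ _+_ _*_ -_ 0# 1#
    _≟_ : DecidableEquality F
    *-inverseʳ : ∀ x → ¬ x ≡ 0# → x * (x ⁻¹) ≡ 1#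
    1≢0 : ¬ 1# ≡ 0#
    NonNeg : F → Set
    nonNeg-+ : ∀ {x y} → NonNeg x → NonNeg y → NonNeg (x + y)
    nonNeg-square : ∀ x → NonNeg (x * x)
    nonNeg-antisym : ∀ {x} → NonNeg x → NonNeg (- x) → x ≡ 0#

  commutativeRing : CommutativeRing _ _
  commutativeRing = record { isCommutativeRing = isCommutativeRing }

-- Finite index sets and their cardinalities

record Finite (S : Set) : Set where
  field
    elems : List S
    _≟_ : DecidableEquality S
    complete : ∀ s → s ∈ elems
    unique : Unique elems

  card : ℕ
  card = length elems

open Finite ⦃ ... ⦄ using (elems; card)

length-cartesianProduct : {A B : Set} (xs : List A) (ys : List B) →
  length (cartesianProduct xs ys) ≡ length xs ℕ.* length ys
length-cartesianProduct [] ys = refl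
length-cartesianProduct (x ∷ xs) ys =
  trans (length-++ (map (x ,_) ys))
    (cong₂ ℕ._+_ (length-map (x ,_) ys) (length-cartesianProduct xs ys))

instance
  finite-⊤ : Finite ⊤
  finite-⊤ = record
    { elems = tt ∷ [] ; _≟_ = λ _ _ → yes refl ; complete = λ _ → here refl ; unique = [] ∷ [] }

  finite-Fin : ∀ {n} → Finite (Fin n)
  finite-Fin {n} = record
    { elems = allFin n ; _≟_ = Fin._≟_ ; complete = ∈-allFin ; unique = Unique.allFin⁺ n }

  finite-× : {S T : Set} → ⦃ Finite S ⦄ → ⦃ Finite T ⦄ → Finite (S × T)
  finite-× ⦃ p ⦄ ⦃ q ⦄ = record
    { elems = cartesianProduct P.elems Q.elems
    ; _≟_ = ≡-dec P._≟_ Q._≟_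
    ; complete = λ (s , t) → ∈-cartesianProduct⁺ (P.complete s) (Q.complete t)
    ; unique = Unique.cartesianProduct⁺ P.unique Q.unique }
    where
    module P = Finite p
    module Q = Finite q

  finite-Vec : ∀ {n m} → Finite (Vec (Fin n) m)
  finite-Vec {n} {zero} = record
    { elems = [] ∷ [] ; _≟_ = Vec.≡-dec Fin._≟_ ; complete = λ { [] → here refl } ; unique = [] ∷ [] }
  finite-Vec {n} {suc m} = record
    { elems = map (uncurry _∷_) P.elems
    ; _≟_ = Vec.≡-dec Fin._≟_
    ; complete = λ { (x ∷ v) → ∈-map⁺ (uncurry _∷_) (P.complete (x , v)) }
    ; unique = Unique.map⁺ (λ { refl → refl }) P.unique }
    where module P = Finite (finite-× {Fin n} {Vec (Fin n) m} ⦃ finite-Fin ⦄ ⦃ finite-Vec ⦄)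

card-Fin : ∀ n → card {Fin n} ≡ n
card-Fin n = length-tabulate {n = n} (λ i → i)

card-× : {S T : Set} ⦃ _ : Finite S ⦄ ⦃ _ : Finite T ⦄ → card {S × T} ≡ card {S} ℕ.* card {T}
card-× {S} {T} = length-cartesianProduct (elems {S}) (elems {T})

card-Vec : ∀ n m → card {Vec (Fin n) m} ≡ n ℕ.^ m
card-Vec n zero = refl
card-Vec n (suc m) = begin
  card {Vec (Fin n) (suc m)}          ≡⟨ length-map (uncurry _∷_) (elems {Fin n × Vec (Fin n) m}) ⟩
  card {Fin n × Vec (Fin n) m}        ≡⟨ card-× {Fin n} {Vec (Fin n) m} ⟩
  card {Fin n} ℕ.* card {Vec (Fin n) m} ≡⟨ cong₂ ℕ._*_ (card-Fin n) (card-Vec n m) ⟩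
  n ℕ.^ suc m                           ∎
  where open ≡-Reasoning

n≤2*⌈n/2⌉ : ∀ n → n ℕ.≤ 2 ℕ.* ℕ.⌈ n /2⌉
n≤2*⌈n/2⌉ n = ℕ.≤-trans (ℕ.≤-reflexive (sym (ℕ.⌊n/2⌋+⌈n/2⌉≡n n)))
  (ℕ.+-mono-≤ (ℕ.⌊n/2⌋≤⌈n/2⌉ n) (ℕ.≤-reflexive (sym (ℕ.+-identityʳ _))))

n≤2^⌈log₂n⌉ : ∀ n → n ℕ.≤ 2 ℕ.^ ⌈log₂ n ⌉
n≤2^⌈log₂n⌉ = <-rec _ λ where
  zero rec → ℕ.z≤n
  (suc zero) rec → ℕ.≤-refl
  n@(suc (suc n′)) rec → ℕ.≤-trans (n≤2*⌈n/2⌉ n) (ℕ.≤-trans (ℕ.*-monoʳ-≤ 2 (rec (ℕ.⌈n/2⌉<n n′)))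
    (ℕ.≤-reflexive (cong (2 ℕ.^_) (trans (cong suc (⌈log₂⌈n/2⌉⌉≡⌈log₂n⌉∸1 n))
      (ℕ.m+[n∸m]≡n (⌈log₂⌉-mono-≤ {2} {n} (ℕ.s≤s (ℕ.s≤s ℕ.z≤n))))))))

module _ (𝔽 : OrderedField) where

  open OrderedField 𝔽
  open CommutativeRing commutativeRing
    using (+-assoc; +-comm; +-identityˡ; +-identityʳ; *-assoc; *-comm; *-identityˡ; *-identityʳ;
           distribˡ; distribʳ; zeroˡ; zeroʳ; -‿inverseˡ; -‿inverseʳ; ring)
  open import Algebra.Properties.Ring ring using (-1*x≈-x; x∙y⁻¹≈ε⇒x≈y; +-inverseʳ-unique)
  open ≡-Reasoning

  -- Arithmetic in an ordered field

  +-interchange : ∀ a b c d → (a + b) + (c + d) ≡ (a + c) + (b + d)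
  +-interchange a b c d = begin
    (a + b) + (c + d) ≡⟨ +-assoc a b (c + d) ⟩
    a + (b + (c + d)) ≡⟨ cong (a +_) (+-assoc b c d) ⟨
    a + ((b + c) + d) ≡⟨ cong (λ z → a + (z + d)) (+-comm b c) ⟩
    a + ((c + b) + d) ≡⟨ cong (a +_) (+-assoc c b d) ⟩
    a + (c + (b + d)) ≡⟨ +-assoc a c (b + d) ⟨
    (a + c) + (b + d) ∎

  *-leftComm : ∀ a b c → a * (b * c) ≡ b * (a * c)
  *-leftComm a b c = trans (sym (*-assoc a b c)) (trans (cong (_* c) (*-comm a b)) (*-assoc b a c))

  nonNeg-0 : NonNeg 0#
  nonNeg-0 = subst NonNeg (zeroˡ 0#) (nonNeg-square 0#)

  nonNeg-1 : NonNeg 1#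
  nonNeg-1 = subst NonNeg (*-identityˡ 1#) (nonNeg-square 1#)

  +-zeroˡ-nonNeg : ∀ {x y} → NonNeg x → NonNeg y → x + y ≡ 0# → x ≡ 0#
  +-zeroˡ-nonNeg {x} {y} p q e = nonNeg-antisym p (subst NonNeg y≡-x q)
    where
    y≡-x : y ≡ - x
    y≡-x = begin
      y               ≡⟨ +-identityˡ y ⟨
      0# + y          ≡⟨ cong (_+ y) (-‿inverseˡ x) ⟨
      ((- x) + x) + y ≡⟨ +-assoc (- x) x y ⟩
      (- x) + (x + y) ≡⟨ cong ((- x) +_) e ⟩
      (- x) + 0#      ≡⟨ +-identityʳ (- x) ⟩
      - x             ∎

  square-zero : ∀ {x} → x * x ≡ 0# → x ≡ 0#
  square-zero {x} e with x ≟ 0#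
  ... | yes p = p
  ... | no x≢0 = begin
    x                  ≡⟨ *-identityʳ x ⟨
    x * 1#             ≡⟨ cong (x *_) (*-inverseʳ x x≢0) ⟨
    x * (x * (x ⁻¹))   ≡⟨ *-assoc x x (x ⁻¹) ⟨
    (x * x) * (x ⁻¹)   ≡⟨ cong (_* (x ⁻¹)) e ⟩
    0# * (x ⁻¹)        ≡⟨ zeroˡ (x ⁻¹) ⟩
    0#                 ∎

  fromℕ : ℕ → F
  fromℕ zero = 0#
  fromℕ (suc n) = 1# + fromℕ n

  nonNeg-fromℕ : ∀ n → NonNeg (fromℕ n)
  nonNeg-fromℕ zero = nonNeg-0
  nonNeg-fromℕ (suc n) = nonNeg-+ nonNeg-1 (nonNeg-fromℕ n)

  fromℕ-suc≢0 : ∀ n → ¬ fromℕ (suc n) ≡ 0#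
  fromℕ-suc≢0 n e = 1≢0 (+-zeroˡ-nonNeg nonNeg-1 (nonNeg-fromℕ n) e)

  -- Bounds on dimensions are obtained as identities between traces in the field, with a nonnegative
  -- defect `r`. This carries them back to ℕ, and works because the characteristic is zero.
  fromℕ-cancel-≤ : ∀ m n r → NonNeg r → fromℕ m + r ≡ fromℕ n → m ℕ.≤ n
  fromℕ-cancel-≤ zero n r p e = ℕ.z≤n
  fromℕ-cancel-≤ (suc m) zero r p e =
    ⊥-elim (fromℕ-suc≢0 m (+-zeroˡ-nonNeg (nonNeg-fromℕ (suc m)) p e))
  fromℕ-cancel-≤ (suc m) (suc n) r p e = ℕ.s≤s (fromℕ-cancel-≤ m n r p (begin
    fromℕ m + r                              ≡⟨ cancel (fromℕ m + r) ⟨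
    (- 1#) + (1# + (fromℕ m + r))            ≡⟨ cong ((- 1#) +_) (+-assoc 1# (fromℕ m) r) ⟨
    (- 1#) + ((1# + fromℕ m) + r)            ≡⟨ cong ((- 1#) +_) e ⟩
    (- 1#) + (1# + fromℕ n)                  ≡⟨ cancel (fromℕ n) ⟩
    fromℕ n                                  ∎))
    where
    cancel : ∀ x → (- 1#) + (1# + x) ≡ x
    cancel x = trans (sym (+-assoc (- 1#) 1# x)) (trans (cong (_+ x) (-‿inverseˡ 1#)) (+-identityˡ x))

  -- Finite sums

  ∑ : {A : Set} → List A → (A → F) → F
  ∑ [] f = 0#
  ∑ (x ∷ xs) f = f x + ∑ xs f

  module _ {A : Set} where

    ∑-cong : (xs : List A) {f g : A → F} → (∀ x → f x ≡ g x) → ∑ xs f ≡ ∑ xs g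
    ∑-cong [] e = refl
    ∑-cong (x ∷ xs) e = cong₂ _+_ (e x) (∑-cong xs e)

    ∑-+ : (xs : List A) (f g : A → F) → ∑ xs (λ x → f x + g x) ≡ ∑ xs f + ∑ xs g
    ∑-+ [] f g = sym (+-identityˡ 0#)
    ∑-+ (x ∷ xs) f g = trans (cong ((f x + g x) +_) (∑-+ xs f g)) (+-interchange (f x) (g x) _ _)

    ∑-*ˡ : (xs : List A) (c : F) (f : A → F) → ∑ xs (λ x → c * f x) ≡ c * ∑ xs f
    ∑-*ˡ [] c f = sym (zeroʳ c)
    ∑-*ˡ (x ∷ xs) c f = trans (cong ((c * f x) +_) (∑-*ˡ xs c f)) (sym (distribˡ c (f x) _))

    ∑-*ʳ : (xs : List A) (c : F) (f : A → F) → ∑ xs (λ x → f x * c) ≡ ∑ xs f * c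
    ∑-*ʳ xs c f = trans (∑-cong xs (λ x → *-comm (f x) c)) (trans (∑-*ˡ xs c f) (*-comm c _))

    ∑-0 : (xs : List A) {f : A → F} → All (λ x → f x ≡ 0#) xs → ∑ xs f ≡ 0#
    ∑-0 [] [] = refl
    ∑-0 (x ∷ xs) (p ∷ ps) = trans (cong₂ _+_ p (∑-0 xs ps)) (+-identityˡ 0#)

    ∑-++ : (xs ys : List A) (f : A → F) → ∑ (xs ++ ys) f ≡ ∑ xs f + ∑ ys f
    ∑-++ [] ys f = sym (+-identityˡ _)
    ∑-++ (x ∷ xs) ys f = trans (cong (f x +_) (∑-++ xs ys f)) (sym (+-assoc (f x) _ _))

    ∑-1 : (xs : List A) → ∑ xs (λ _ → 1#) ≡ fromℕ (length xs)
    ∑-1 [] = refl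
    ∑-1 (x ∷ xs) = cong (1# +_) (∑-1 xs)

    ∑-nonNeg : (xs : List A) {f : A → F} → (∀ x → NonNeg (f x)) → NonNeg (∑ xs f)
    ∑-nonNeg [] p = nonNeg-0
    ∑-nonNeg (x ∷ xs) p = nonNeg-+ (p x) (∑-nonNeg xs p)

    ∑-nonNeg-zero : (xs : List A) {f : A → F} → (∀ x → NonNeg (f x)) → ∑ xs f ≡ 0# →
      ∀ {x} → x ∈ xs → f x ≡ 0#
    ∑-nonNeg-zero (x ∷ xs) p e (here refl) = +-zeroˡ-nonNeg (p x) (∑-nonNeg xs p) e
    ∑-nonNeg-zero (x ∷ xs) p e (there i) = ∑-nonNeg-zero xs p
      (+-zeroˡ-nonNeg (∑-nonNeg xs p) (p x) (trans (+-comm _ _) e)) i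

    ∑-map : {B : Set} (g : B → A) (xs : List B) (f : A → F) → ∑ (map g xs) f ≡ ∑ xs (λ x → f (g x))
    ∑-map g [] f = refl
    ∑-map g (x ∷ xs) f = cong (f (g x) +_) (∑-map g xs f)

    ∑-↭ : {xs ys : List A} (f : A → F) → xs ↭ ys → ∑ xs f ≡ ∑ ys f
    ∑-↭ f ↭.refl = refl
    ∑-↭ f (↭.prep x p) = cong (f x +_) (∑-↭ f p)
    ∑-↭ f (↭.swap {xs = xs} {ys} x y p) = begin
      f x + (f y + ∑ xs f) ≡⟨ cong (λ z → f x + (f y + z)) (∑-↭ f p) ⟩
      f x + (f y + ∑ ys f) ≡⟨ +-assoc _ _ _ ⟨
      (f x + f y) + ∑ ys f ≡⟨ cong (_+ ∑ ys f) (+-comm _ _) ⟩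
      (f y + f x) + ∑ ys f ≡⟨ +-assoc _ _ _ ⟩
      f y + (f x + ∑ ys f) ∎
    ∑-↭ f (↭.trans p q) = trans (∑-↭ f p) (∑-↭ f q)

  ∑-swap : {A B : Set} (xs : List A) (ys : List B) (f : A → B → F) →
    ∑ xs (λ x → ∑ ys (f x)) ≡ ∑ ys (λ y → ∑ xs (λ x → f x y))
  ∑-swap [] ys f = sym (∑-0 ys (All.universal (λ _ → refl) ys))
  ∑-swap (x ∷ xs) ys f =
    trans (cong (∑ ys (f x) +_) (∑-swap xs ys f)) (sym (∑-+ ys (f x) _))

  ∑-cartesianProduct : {A B : Set} (xs : List A) (ys : List B) (f : A × B → F) →
    ∑ (cartesianProduct xs ys) f ≡ ∑ xs (λ x → ∑ ys (λ y → f (x , y)))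
  ∑-cartesianProduct [] ys f = refl
  ∑-cartesianProduct (x ∷ xs) ys f = trans (∑-++ (map (x ,_) ys) _ f)
    (cong₂ _+_ (∑-map (x ,_) ys f) (∑-cartesianProduct xs ys f))

  module _ {S : Set} ⦃ fin : Finite S ⦄ where

    private module S = Finite fin

    ∑ₛ : (S → F) → F
    ∑ₛ = ∑ S.elems

    δ : S → S → F
    δ s t with s S.≟ t
    ... | yes _ = 1#
    ... | no _ = 0#

    δ-same : ∀ s → δ s s ≡ 1#
    δ-same s with s S.≟ s
    ... | yes _ = refl
    ... | no s≢s = ⊥-elim (s≢s refl)

    δ-diff : ∀ {s t} → ¬ s ≡ t → δ s t ≡ 0#
    δ-diff {s} {t} s≢t with s S.≟ t
    ... | yes e = ⊥-elim (s≢t e)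
    ... | no _ = refl

    δ-sym : ∀ s t → δ s t ≡ δ t s
    δ-sym s t with s S.≟ t
    ... | yes refl = sym (δ-same s)
    ... | no s≢t = sym (δ-diff (λ e → s≢t (sym e)))

    ∑-supported : (s : S) (f : S → F) → (∀ t → ¬ s ≡ t → f t ≡ 0#) → ∑ₛ f ≡ f s
    ∑-supported s f z = go S.elems S.unique (S.complete s)
      where
      go : ∀ xs → Unique xs → s ∈ xs → ∑ xs f ≡ f s
      go (x ∷ xs) (u ∷ _) (here refl) =
        trans (cong (f s +_) (∑-0 xs (All.map (λ {t} → z t) u))) (+-identityʳ (f s))
      go (x ∷ xs) (u ∷ us) (there i) =
        trans (cong₂ _+_ (z x (λ { refl → All.lookup u i refl })) (go xs us i)) (+-identityˡ (f s))

    ∑-δˡ : (s : S) (f : S → F) → ∑ₛ (λ t → δ s t * f t) ≡ f s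
    ∑-δˡ s f = trans
      (∑-supported s _ (λ t s≢t → trans (cong (_* f t) (δ-diff s≢t)) (zeroˡ (f t))))
      (trans (cong (_* f s) (δ-same s)) (*-identityˡ (f s)))

  minus-zero⇒≡ : ∀ {a b} → a + (- 1#) * b ≡ 0# → a ≡ b
  minus-zero⇒≡ {a} {b} e = x∙y⁻¹≈ε⇒x≈y a b (trans (cong (a +_) (sym (-1*x≈-x b))) e)

  ≡⇒minus-zero : ∀ {a b} → a ≡ b → a + (- 1#) * b ≡ 0#
  ≡⇒minus-zero {a} refl = trans (cong (a +_) (-1*x≈-x a)) (-‿inverseʳ a)

  -- Vectors and orthogonal projections

  V : Set → Set
  V S = S → F

  module _ {S : Set} where

    infix 4 _≈_
    infixl 6 _⊕_ _⊖_
    infixr 7 _·_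

    _≈_ : V S → V S → Set
    x ≈ y = ∀ s → x s ≡ y s

    𝟘 : V S
    𝟘 _ = 0#

    _⊕_ : V S → V S → V S
    (x ⊕ y) s = x s + y s

    _·_ : F → V S → V S
    (c · x) s = c * x s

    _⊖_ : V S → V S → V S
    x ⊖ y = x ⊕ (- 1#) · y

    ≈-refl : {x : V S} → x ≈ x
    ≈-refl s = refl

    ≈-sym : {x y : V S} → x ≈ y → y ≈ x
    ≈-sym e s = sym (e s)

    ≈-trans : {x y z : V S} → x ≈ y → y ≈ z → x ≈ z
    ≈-trans e e′ s = trans (e s) (e′ s)

    ⊕-cong : {x x′ y y′ : V S} → x ≈ x′ → y ≈ y′ → x ⊕ y ≈ x′ ⊕ y′
    ⊕-cong e e′ s = cong₂ _+_ (e s) (e′ s)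

    ·-cong : ∀ c {x y : V S} → x ≈ y → c · x ≈ c · y
    ·-cong c e s = cong (c *_) (e s)

    ⊖≈𝟘⇒≈ : {x y : V S} → x ⊖ y ≈ 𝟘 → x ≈ y
    ⊖≈𝟘⇒≈ e s = minus-zero⇒≡ (e s)

    ≈⇒⊖≈𝟘 : {x y : V S} → x ≈ y → x ⊖ y ≈ 𝟘
    ≈⇒⊖≈𝟘 e s = ≡⇒minus-zero (e s)

    -- Subspaces are bare predicates: membership in those that come from colourings need not be
    -- decidable, so a basis exists only under a double negation.
    record IsSubspace (P : V S → Set) : Set where
      field
        resp : ∀ {x y} → x ≈ y → P x → P y
        origin : P 𝟘
        add : ∀ {x y} → P x → P y → P (x ⊕ y)
        scale : ∀ c {x} → P x → P (c · x)

      sub : ∀ {x y} → P x → P y → P (x ⊖ y)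
      sub p q = add p (scale (- 1#) q)

    data Span (P : V S → Set) : V S → Set where
      gen : ∀ {x} → P x → Span P x
      origin : Span P 𝟘
      add : ∀ {x y} → Span P x → Span P y → Span P (x ⊕ y)
      scale : ∀ c {x} → Span P x → Span P (c · x)
      resp : ∀ {x y} → x ≈ y → Span P x → Span P y

    span-isSubspace : ∀ {P} → IsSubspace (Span P)
    span-isSubspace = record { resp = resp ; origin = origin ; add = add ; scale = scale }

    span-least : ∀ {P Q} → IsSubspace Q → (∀ {x} → P x → Q x) → ∀ {x} → Span P x → Q x
    span-least Q f (gen p) = f p
    span-least Q f origin = IsSubspace.origin Q
    span-least Q f (add p q) = IsSubspace.add Q (span-least Q f p) (span-least Q f q)
    span-least Q f (scale c p) = IsSubspace.scale Q c (span-least Q f p)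
    span-least Q f (resp e p) = IsSubspace.resp Q e (span-least Q f p)

    span-mono : ∀ {P Q} → (∀ {x} → P x → Q x) → ∀ {x} → Span P x → Span Q x
    span-mono f = span-least span-isSubspace (λ p → gen (f p))

    ⊕-interchange : (a b c d : V S) → (a ⊕ b) ⊕ (c ⊕ d) ≈ (a ⊕ c) ⊕ (b ⊕ d)
    ⊕-interchange a b c d s = +-interchange (a s) (b s) (c s) (d s)

    span-∷ : ∀ {x L} → ∀ {r} → Span (_∈ (x ∷ L)) r → ∃ λ t → ∃ λ c → Span (_∈ L) t × r ≈ t ⊕ c · x
    span-∷ {x} {L} = span-least sub from
      where
      from : ∀ {r} → r ∈ (x ∷ L) → ∃ λ t → ∃ λ c → Span (_∈ L) t × r ≈ t ⊕ c · x
      from (here refl) = 𝟘 , 1# , origin , λ s → sym (trans (+-identityˡ _) (*-identityˡ (x s)))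
      from {r} (there i) = r , 0# , gen i , λ s → sym (trans (cong (r s +_) (zeroˡ (x s))) (+-identityʳ (r s)))
      sub : IsSubspace (λ r → ∃ λ t → ∃ λ c → Span (_∈ L) t × r ≈ t ⊕ c · x)
      sub = record
        { resp = λ e (t , c , p , q) → t , c , p , ≈-trans (≈-sym e) q
        ; origin = 𝟘 , 0# , origin , λ s → sym (trans (+-identityˡ _) (zeroˡ (x s)))
        ; add = λ (t , c , p , q) (t′ , c′ , p′ , q′) → t ⊕ t′ , c + c′ , add p p′ ,
            ≈-trans (⊕-cong q q′) (≈-trans (⊕-interchange t (c · x) t′ (c′ · x))
              (⊕-cong ≈-refl (λ s → sym (distribʳ (x s) c c′))))
        ; scale = λ a (t , c , p , q) → a · t , a * c , scale a p ,
            λ s → trans (cong (a *_) (q s)) (trans (distribˡ a (t s) (c * x s))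
              (cong (a * t s +_) (sym (*-assoc a c (x s)))))
        }

    record IsLinear {T : Set} (f : V S → V T) : Set where
      field
        f-cong : ∀ {x y} → x ≈ y → ∀ t → f x t ≡ f y t
        f-⊕ : ∀ x y t → f (x ⊕ y) t ≡ f x t + f y t
        f-· : ∀ c x t → f (c · x) t ≡ c * f x t

      f-𝟘 : ∀ t → f 𝟘 t ≡ 0#
      f-𝟘 t = trans (f-cong {𝟘} {0# · 𝟘} (λ s → sym (zeroˡ 0#)) t) (trans (f-· 0# 𝟘 t) (zeroˡ _))

      f-⊖ : ∀ x y t → f (x ⊖ y) t ≡ f x t + (- 1#) * f y t
      f-⊖ x y t = trans (f-⊕ x _ t) (cong (f x t +_) (f-· (- 1#) y t))

  module _ {S : Set} ⦃ fin : Finite S ⦄ where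

    ⟨_∣_⟩ : V S → V S → F
    ⟨ x ∣ y ⟩ = ∑ₛ (λ s → x s * y s)

    ip-cong : {x x′ y y′ : V S} → x ≈ x′ → y ≈ y′ → ⟨ x ∣ y ⟩ ≡ ⟨ x′ ∣ y′ ⟩
    ip-cong e e′ = ∑-cong (elems {S}) (λ s → cong₂ _*_ (e s) (e′ s))

    ip-comm : (x y : V S) → ⟨ x ∣ y ⟩ ≡ ⟨ y ∣ x ⟩
    ip-comm x y = ∑-cong (elems {S}) (λ s → *-comm (x s) (y s))

    ip-⊕ˡ : (x y z : V S) → ⟨ x ⊕ y ∣ z ⟩ ≡ ⟨ x ∣ z ⟩ + ⟨ y ∣ z ⟩
    ip-⊕ˡ x y z = trans (∑-cong (elems {S}) (λ s → distribʳ (z s) (x s) (y s))) (∑-+ (elems {S}) _ _)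

    ip-·ˡ : (c : F) (x y : V S) → ⟨ c · x ∣ y ⟩ ≡ c * ⟨ x ∣ y ⟩
    ip-·ˡ c x y = trans (∑-cong (elems {S}) (λ s → *-assoc c (x s) (y s))) (∑-*ˡ (elems {S}) c _)

    ip-⊖ˡ : (x y z : V S) → ⟨ x ⊖ y ∣ z ⟩ ≡ ⟨ x ∣ z ⟩ + (- 1#) * ⟨ y ∣ z ⟩
    ip-⊖ˡ x y z = trans (ip-⊕ˡ x _ z) (cong (⟨ x ∣ z ⟩ +_) (ip-·ˡ (- 1#) y z))

    ip-⊕ʳ : (x y z : V S) → ⟨ x ∣ y ⊕ z ⟩ ≡ ⟨ x ∣ y ⟩ + ⟨ x ∣ z ⟩
    ip-⊕ʳ x y z = trans (ip-comm x _) (trans (ip-⊕ˡ y z x) (cong₂ _+_ (ip-comm y x) (ip-comm z x)))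

    ip-·ʳ : (c : F) (x y : V S) → ⟨ x ∣ c · y ⟩ ≡ c * ⟨ x ∣ y ⟩
    ip-·ʳ c x y = trans (ip-comm x _) (trans (ip-·ˡ c y x) (cong (c *_) (ip-comm y x)))

    ip-𝟘ʳ : (x : V S) → ⟨ x ∣ 𝟘 ⟩ ≡ 0#
    ip-𝟘ʳ x = ∑-0 (elems {S}) (All.universal (λ s → zeroʳ (x s)) (elems {S}))

    ip-𝟘ˡ : (x : V S) → ⟨ 𝟘 ∣ x ⟩ ≡ 0#
    ip-𝟘ˡ x = trans (ip-comm 𝟘 x) (ip-𝟘ʳ x)

    ip-definite : (x : V S) → ⟨ x ∣ x ⟩ ≡ 0# → x ≈ 𝟘
    ip-definite x e s =
      square-zero (∑-nonNeg-zero (elems {S}) (λ s → nonNeg-square (x s)) e (Finite.complete fin s))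

    -- Definiteness turns the vanishing of a vector into one equation in the field. Hence membership
    -- in the span of a given orthogonal list is decidable, whatever the colours are.
    ≈𝟘? : (x : V S) → Dec (x ≈ 𝟘)
    ≈𝟘? x with ⟨ x ∣ x ⟩ ≟ 0#
    ... | yes e = yes (ip-definite x e)
    ... | no ne = no (λ e → ne (trans (ip-cong e ≈-refl) (ip-𝟘ˡ x)))

    perp-isSubspace : (x : V S) → IsSubspace (λ y → ⟨ x ∣ y ⟩ ≡ 0#)
    perp-isSubspace x = record
      { resp = λ e p → trans (ip-cong {x} ≈-refl (≈-sym e)) p
      ; origin = ip-𝟘ʳ x
      ; add = λ {y} {z} p q → trans (ip-⊕ʳ x y z) (trans (cong₂ _+_ p q) (+-identityˡ 0#))
      ; scale = λ c {y} p → trans (ip-·ʳ c x y) (trans (cong (c *_) p) (zeroʳ c))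
      }

    Orth : List (V S) → Set
    Orth [] = ⊤
    Orth (x ∷ L) = ¬ x ≈ 𝟘 × All (λ y → ⟨ x ∣ y ⟩ ≡ 0#) L × Orth L

    -- The members of `O` cannot be scaled to unit length without square roots, hence the division
    -- by their squared lengths.
    proj : List (V S) → V S → V S
    proj [] x = 𝟘
    proj (o ∷ O) x = (⟨ x ∣ o ⟩ * (⟨ o ∣ o ⟩ ⁻¹)) · o ⊕ proj O x

    proj-closed : ∀ {P} → IsSubspace P → ∀ {O} → All P O → ∀ x → P (proj O x)
    proj-closed P [] x = IsSubspace.origin P
    proj-closed P (p ∷ ps) x = IsSubspace.add P (IsSubspace.scale P _ p) (proj-closed P ps x)

    norm-inverse : (o : V S) → ¬ o ≈ 𝟘 → ⟨ o ∣ o ⟩ * (⟨ o ∣ o ⟩ ⁻¹) ≡ 1#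
    norm-inverse o o≉0 = *-inverseʳ _ (λ e → o≉0 (ip-definite o e))

    proj-⊥ : ∀ {O} → Orth O → ∀ x → All (λ o → ⟨ o ∣ x ⊖ proj O x ⟩ ≡ 0#) O
    proj-⊥ {[]} _ x = []
    proj-⊥ {o ∷ O} (o≉0 , o⊥O , orth) x = first ∷ All.zipWith rest (o⊥O , proj-⊥ orth x)
      where
      c : F
      c = ⟨ x ∣ o ⟩ * (⟨ o ∣ o ⟩ ⁻¹)
      expand : ∀ p → ⟨ p ∣ proj (o ∷ O) x ⟩ ≡ c * ⟨ p ∣ o ⟩ + ⟨ p ∣ proj O x ⟩
      expand p = trans (ip-⊕ʳ p (c · o) _) (cong (_+ ⟨ p ∣ proj O x ⟩) (ip-·ʳ c p o))
      diff : ∀ p q → ⟨ p ∣ x ⊖ q ⟩ ≡ ⟨ p ∣ x ⟩ + (- 1#) * ⟨ p ∣ q ⟩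
      diff p q = trans (ip-⊕ʳ p x _) (cong (⟨ p ∣ x ⟩ +_) (ip-·ʳ (- 1#) p q))
      first : ⟨ o ∣ x ⊖ proj (o ∷ O) x ⟩ ≡ 0#
      first = trans (diff o _) (≡⇒minus-zero (begin
        ⟨ o ∣ x ⟩                                    ≡⟨ ip-comm o x ⟩
        ⟨ x ∣ o ⟩                                    ≡⟨ *-identityʳ _ ⟨
        ⟨ x ∣ o ⟩ * 1#                               ≡⟨ cong (⟨ x ∣ o ⟩ *_) (trans (*-comm _ _) (norm-inverse o o≉0)) ⟨
        ⟨ x ∣ o ⟩ * ((⟨ o ∣ o ⟩ ⁻¹) * ⟨ o ∣ o ⟩)     ≡⟨ *-assoc _ _ _ ⟨
        c * ⟨ o ∣ o ⟩                                ≡⟨ +-identityʳ _ ⟨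
        c * ⟨ o ∣ o ⟩ + 0#                           ≡⟨ cong (c * ⟨ o ∣ o ⟩ +_) (proj-closed (perp-isSubspace o) o⊥O x) ⟨
        c * ⟨ o ∣ o ⟩ + ⟨ o ∣ proj O x ⟩             ≡⟨ expand o ⟨
        ⟨ o ∣ proj (o ∷ O) x ⟩                       ∎))
      rest : ∀ {p} → ⟨ o ∣ p ⟩ ≡ 0# × ⟨ p ∣ x ⊖ proj O x ⟩ ≡ 0# → ⟨ p ∣ x ⊖ proj (o ∷ O) x ⟩ ≡ 0#
      rest {p} (o⊥p , e) = trans (diff p _) (≡⇒minus-zero (begin
        ⟨ p ∣ x ⟩                         ≡⟨ minus-zero⇒≡ (trans (sym (diff p _)) e) ⟩
        ⟨ p ∣ proj O x ⟩                  ≡⟨ +-identityˡ _ ⟨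
        0# + ⟨ p ∣ proj O x ⟩             ≡⟨ cong (_+ ⟨ p ∣ proj O x ⟩) (trans (cong (c *_) (trans (ip-comm p o) o⊥p)) (zeroʳ c)) ⟨
        c * ⟨ p ∣ o ⟩ + ⟨ p ∣ proj O x ⟩  ≡⟨ expand p ⟨
        ⟨ p ∣ proj (o ∷ O) x ⟩            ∎))

    proj-isLinear : ∀ O → IsLinear (proj O)
    proj-isLinear [] = record
      { f-cong = λ _ _ → refl ; f-⊕ = λ _ _ _ → sym (+-identityˡ 0#) ; f-· = λ c _ _ → sym (zeroʳ c) }
    proj-isLinear (o ∷ O) = record
      { f-cong = λ e s → cong₂ _+_ (cong (λ z → z * i * o s) (ip-cong e ≈-refl)) (f-cong e s)
      ; f-⊕ = λ x y s → trans
          (cong₂ _+_ (trans (cong (_* o s) (trans (cong (_* i) (ip-⊕ˡ x y o)) (distribʳ i _ _)))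
                              (distribʳ (o s) _ _))
                     (f-⊕ x y s))
          (+-interchange _ _ _ _)
      ; f-· = λ c x s → trans
          (cong₂ _+_ (trans (cong (_* o s) (trans (cong (_* i) (ip-·ˡ c x o)) (*-assoc c _ i)))
                              (*-assoc c _ (o s)))
                     (f-· c x s))
          (sym (distribˡ c _ _))
      }
      where
      open IsLinear (proj-isLinear O)
      i : F
      i = ⟨ o ∣ o ⟩ ⁻¹

    ip-δʳ : (x : V S) (s : S) → ⟨ x ∣ δ s ⟩ ≡ x s
    ip-δʳ x s = trans (ip-comm x (δ s)) (∑-δˡ s x)

    -- The projection onto a single line has trace ⟨o∣o⟩ · ⟨o∣o⟩⁻¹ = 1.
    trace-proj : ∀ {O} → Orth O → ∑ₛ (λ s → proj O (δ s) s) ≡ fromℕ (length O)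
    trace-proj {[]} _ = ∑-0 (elems {S}) (All.universal (λ _ → refl) (elems {S}))
    trace-proj {o ∷ O} (o≉0 , _ , orth) = trans (∑-+ (elems {S}) _ _) (cong₂ _+_ unit (trace-proj orth))
      where
      i : F
      i = ⟨ o ∣ o ⟩ ⁻¹
      unit : ∑ₛ (λ s → (⟨ δ s ∣ o ⟩ * i) * o s) ≡ 1#
      unit = begin
        ∑ₛ (λ s → (⟨ δ s ∣ o ⟩ * i) * o s)  ≡⟨ ∑-cong (elems {S}) (λ s → trans (cong (λ z → z * i * o s) (∑-δˡ s o))
                                                  (trans (*-assoc _ _ _) (trans (cong (o s *_) (*-comm i (o s))) (sym (*-assoc _ _ _))))) ⟩
        ∑ₛ (λ s → (o s * o s) * i)          ≡⟨ ∑-*ʳ (elems {S}) i _ ⟩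
        ⟨ o ∣ o ⟩ * i                       ≡⟨ norm-inverse o o≉0 ⟩
        1#                                  ∎

    -- Bessel's inequality for the unit vectors, summed: the trace of an orthogonal projection is its rank.
    orth-length : ∀ {O} → Orth O → length O ℕ.≤ card {S}
    orth-length {O} orth = fromℕ-cancel-≤ _ _ (∑ₛ (λ s → ⟨ r s ∣ r s ⟩))
      (∑-nonNeg (elems {S}) (λ s → ∑-nonNeg (elems {S}) (λ t → nonNeg-square (r s t)))) (begin
        fromℕ (length O) + ∑ₛ (λ s → ⟨ r s ∣ r s ⟩)                ≡⟨ cong (_+ ∑ₛ (λ s → ⟨ r s ∣ r s ⟩)) (trace-proj orth) ⟨
        ∑ₛ (λ s → proj O (δ s) s) + ∑ₛ (λ s → ⟨ r s ∣ r s ⟩)       ≡⟨ ∑-+ (elems {S}) _ _ ⟨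
        ∑ₛ (λ s → proj O (δ s) s + ⟨ r s ∣ r s ⟩)                  ≡⟨ ∑-cong (elems {S}) split ⟩
        ∑ (elems {S}) (λ s → 1#)                                    ≡⟨ ∑-1 (elems {S}) ⟩
        fromℕ (card {S})                                               ∎)
      where
      r : S → V S
      r s = δ s ⊖ proj O (δ s)
      r-proj : ∀ s → ⟨ r s ∣ proj O (δ s) ⟩ ≡ 0#
      r-proj s = proj-closed (perp-isSubspace (r s))
        (All.map (λ {o} e → trans (ip-comm (r s) o) e) (proj-⊥ orth (δ s))) (δ s)
      -- Since `r s` is orthogonal to the projection of `δ s`, its squared length is ⟨r s∣δ s⟩,
      -- which is 1 minus the diagonal entry of the projection.
      split : ∀ s → proj O (δ s) s + ⟨ r s ∣ r s ⟩ ≡ 1#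
      split s = begin
        p s + ⟨ r s ∣ r s ⟩        ≡⟨ cong (p s +_) (trans (ip-⊕ʳ (r s) (δ s) _) (trans (cong (⟨ r s ∣ δ s ⟩ +_)
                                        (trans (ip-·ʳ (- 1#) (r s) p) (trans (cong ((- 1#) *_) (r-proj s)) (zeroʳ _)))) (+-identityʳ _))) ⟩
        p s + ⟨ r s ∣ δ s ⟩        ≡⟨ cong (p s +_) (ip-δʳ (r s) s) ⟩
        p s + (δ s s + (- 1#) * p s) ≡⟨ +-comm _ _ ⟩
        (δ s s + (- 1#) * p s) + p s ≡⟨ +-assoc _ _ _ ⟩
        δ s s + ((- 1#) * p s + p s) ≡⟨ cong (δ s s +_) (trans (+-comm _ _) (≡⇒minus-zero refl)) ⟩
        δ s s + 0#                 ≡⟨ +-identityʳ _ ⟩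
        δ s s                      ≡⟨ δ-same s ⟩
        1#                         ∎
        where
        p : V S
        p = proj O (δ s)

    orth-extend : ∀ {O} → Orth O → ∀ x → ¬ x ≈ proj O x → Orth ((x ⊖ proj O x) ∷ O)
    orth-extend orth x x≉ = (λ e → x≉ (⊖≈𝟘⇒≈ e)) , All.map (λ {o} e → trans (ip-comm _ o) e) (proj-⊥ orth x) , orth

    ≈-proj? : ∀ O x → Dec (x ≈ proj O x)
    ≈-proj? O x with ≈𝟘? (x ⊖ proj O x)
    ... | yes e = yes (⊖≈𝟘⇒≈ e)
    ... | no ne = no (λ e → ne (≈⇒⊖≈𝟘 e))

  -- Each appeal to excluded middle either certifies maximality or yields a longer list, and the
  -- bound `b` leaves room for at most `b` improvements; the fuel `m` counts those that remain.
  maximal : {A : Set} (Q : List A → Set) (b : ℕ) → Q [] → (∀ {L} → Q L → length L ℕ.≤ b) →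
    ¬ ¬ ∃ λ L → Q L × (∀ {L′} → Q L′ → length L′ ℕ.≤ length L)
  maximal {A} Q b q bound k = go b [] q (ℕ.m≤m+n b 0)
    where
    go : ∀ m L → Q L → b ℕ.≤ m ℕ.+ length L → _
    go m L p le = ¬¬-excluded-middle {A = ∃ λ L′ → Q L′ × length L ℕ.< length L′} λ where
        (no none) → k (L , p , λ {L′} p′ → ℕ.≮⇒≥ (λ lt → none (L′ , p′ , lt)))
        (yes (L′ , p′ , lt)) → step m le L′ p′ lt
      where
      step : ∀ m → b ℕ.≤ m ℕ.+ length L → ∀ L′ → Q L′ → length L ℕ.< length L′ → _
      step zero le L′ p′ lt = ℕ.<⇒≱ lt (ℕ.≤-trans (bound p′) le)
      step (suc m) le L′ p′ lt = go m L′ p′ (ℕ.≤-trans le (ℕ.≤-trans (ℕ.≤-reflexive (sym (ℕ.+-suc m _))) (ℕ.+-monoʳ-≤ m lt)))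

  module _ {S : Set} ⦃ fin : Finite S ⦄ where

    record Basis (P : V S → Set) (O : List (V S)) : Set where
      field
        orth : Orth O
        members : All P O
        spans : ∀ {x} → P x → x ≈ proj O x

      residue-⊥ : ∀ x {p} → P p → ⟨ x ⊖ proj O x ∣ p ⟩ ≡ 0#
      residue-⊥ x {p} m = IsSubspace.resp (perp-isSubspace _) (≈-sym (spans m))
        (proj-closed (perp-isSubspace _) (All.map (λ {o} e → trans (ip-comm _ o) e) (proj-⊥ orth x)) p)

    -- An orthogonal list of maximal length in `P` spans it, since the residue of a missed vector
    -- would extend the list.
    exists-basis : ∀ {P} → IsSubspace P → ¬ ¬ ∃ (Basis P)
    exists-basis {P} sub k =
      maximal (λ O → Orth O × All P O) (card {S}) (tt , []) (λ (o , _) → orth-length o) λ where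
        (O , (orth , mem) , max) → k (O , record
          { orth = orth ; members = mem ; spans = spans O orth mem max })
      where
      spans : ∀ O → Orth O → All P O → (∀ {L′} → Orth L′ × All P L′ → length L′ ℕ.≤ length O) →
        ∀ {x} → P x → x ≈ proj O x
      spans O orth mem max {x} p with ≈-proj? O x
      ... | yes e = e
      ... | no ne = ⊥-elim (ℕ.<-irrefl refl
        (max (orth-extend orth x ne , IsSubspace.sub sub p (proj-closed sub mem x) ∷ mem)))

    module _ {T : Set} ⦃ finT : Finite T ⦄ (f : V S → V T) (lin : IsLinear f) where
      open IsLinear lin

      -- Gram–Schmidt applied to the image of an orthogonal list.
      orth-image : ∀ L → Orth L → (∀ {t} → Span (_∈ L) t → f t ≈ 𝟘 → t ≈ 𝟘) →
        ∃ λ O → Orth O × length O ≡ length L × All (λ o → ∃ λ t → Span (_∈ L) t × o ≈ f t) O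
      orth-image [] _ _ = [] , tt , refl , []
      orth-image (x ∷ L) (x≉0 , x⊥L , orth) inj
        with O , orthO , len , im ← orth-image L orth (λ t e → inj (span-mono there t) e)
        = f x ⊖ proj O (f x) ∷ O
        -- If `f x` equalled its projection `f u`, with `u` in the span of `L`, then injectivity
        -- would give `x ≈ u`; but `x` is orthogonal to `L` and nonzero.
        , orth-extend orthO (f x) (λ e → x≉0 (ip-definite x (trans
            (ip-cong {x = x} ≈-refl
              (⊖≈𝟘⇒≈ (inj (add (gen (here refl)) (scale (- 1#) (span-mono there t)))
                (λ s → trans (f-⊖ x u s) (≡⇒minus-zero (trans (e s) (pe s)))))))
            (span-least (perp-isSubspace x) (All.lookup x⊥L) t))))
        , cong suc len
        , (x ⊖ u , add (gen (here refl)) (scale (- 1#) (span-mono there t))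
            , λ s → trans (cong (λ z → f x s + (- 1#) * z) (pe s)) (sym (f-⊖ x u s)))
          ∷ All.map (λ (t , p , e) → t , span-mono there p , e) im
        where
        image-isSubspace : IsSubspace (λ o → ∃ λ t → Span (_∈ L) t × o ≈ f t)
        image-isSubspace = record
          { resp = λ e (t , p , q) → t , p , ≈-trans (≈-sym e) q
          ; origin = 𝟘 , origin , λ s → sym (f-𝟘 s)
          ; add = λ (t , p , q) (t′ , p′ , q′) → t ⊕ t′ , add p p′ ,
              λ s → trans (cong₂ _+_ (q s) (q′ s)) (sym (f-⊕ t t′ s))
          ; scale = λ c (t , p , q) → c · t , scale c p ,
              λ s → trans (cong (c *_) (q s)) (sym (f-· c t s))
          }
        preimage : ∃ λ t → Span (_∈ L) t × proj O (f x) ≈ f t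
        preimage = proj-closed image-isSubspace im (f x)
        u : V S
        u = proj₁ preimage
        t : Span (_∈ L) u
        t = proj₁ (proj₂ preimage)
        pe : proj O (f x) ≈ f u
        pe = proj₂ (proj₂ preimage)

      -- Both dimension bounds of the proof come from here: with `f` the evaluation at a separating
      -- vector for tori, and with `f = blocks` for the algebra generated by a colouring.
      orth-length-via : ∀ {L} → Orth L → (∀ {t} → Span (_∈ L) t → f t ≈ 𝟘 → t ≈ 𝟘) →
        length L ℕ.≤ card {T}
      orth-length-via {L} orth inj with O , orthO , len , _ ← orth-image L orth inj =
        subst (ℕ._≤ card {T}) len (orth-length orthO)

  -- Matrices

  Mat : Set → Set → Set
  Mat S T = V (S × T)

  infixl 7 _⊗_
  infix 8 _ᵀ

  _ᵀ : {S T : Set} → Mat S T → Mat T S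
  (A ᵀ) (i , j) = A (j , i)

  _⊗_ : {S T U : Set} → ⦃ Finite T ⦄ → Mat S T → Mat T U → Mat S U
  (A ⊗ B) (i , k) = ∑ₛ (λ j → A (i , j) * B (j , k))

  one : {S : Set} → ⦃ Finite S ⦄ → Mat S S
  one (i , j) = δ i j

  module _ {S T U : Set} ⦃ finT : Finite T ⦄ where

    ⊗-cong : {A A′ : Mat S T} {B B′ : Mat T U} → A ≈ A′ → B ≈ B′ → A ⊗ B ≈ A′ ⊗ B′
    ⊗-cong e e′ (i , k) = ∑-cong (elems {T}) (λ j → cong₂ _*_ (e (i , j)) (e′ (j , k)))

    ⊗-isLinearˡ : (B : Mat T U) → IsLinear {S × T} (_⊗ B)
    ⊗-isLinearˡ B = record
      { f-cong = λ e → ⊗-cong e ≈-refl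
      ; f-⊕ = λ A A′ (i , k) → trans (∑-cong (elems {T}) (λ j → distribʳ _ _ _)) (∑-+ (elems {T}) _ _)
      ; f-· = λ c A (i , k) → trans (∑-cong (elems {T}) (λ j → *-assoc c _ _)) (∑-*ˡ (elems {T}) c _)
      }

    ⊗-isLinearʳ : (A : Mat S T) → IsLinear {T × U} (A ⊗_)
    ⊗-isLinearʳ A = record
      { f-cong = λ e → ⊗-cong {A} ≈-refl e
      ; f-⊕ = λ B B′ (i , k) → trans (∑-cong (elems {T}) (λ j → distribˡ _ _ _)) (∑-+ (elems {T}) _ _)
      ; f-· = λ c B (i , k) → trans (∑-cong (elems {T}) (λ j → *-leftComm _ c _)) (∑-*ˡ (elems {T}) c _)
      }

    ᵀ-⊗ : (A : Mat S T) (B : Mat T U) → (A ⊗ B) ᵀ ≈ B ᵀ ⊗ A ᵀ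
    ᵀ-⊗ A B (k , i) = ∑-cong (elems {T}) (λ j → *-comm _ _)

    module _ ⦃ finS : Finite S ⦄ ⦃ finU : Finite U ⦄ where

      adjointˡ : (A : Mat S T) (B : Mat T U) (C : Mat S U) → ⟨ A ⊗ B ∣ C ⟩ ≡ ⟨ B ∣ A ᵀ ⊗ C ⟩
      adjointˡ A B C = begin
        ⟨ A ⊗ B ∣ C ⟩
          ≡⟨ ∑-cartesianProduct (elems {S}) (elems {U}) _ ⟩
        ∑ (elems {S}) (λ i → ∑ (elems {U}) (λ k → ∑ (elems {T}) (λ j → A (i , j) * B (j , k)) * C (i , k)))
          ≡⟨ ∑-cong (elems {S}) (λ i → trans
               (∑-cong (elems {U}) (λ k → sym (∑-*ʳ (elems {T}) (C (i , k)) _)))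
               (∑-swap (elems {U}) (elems {T}) _)) ⟩
        ∑ (elems {S}) (λ i → ∑ (elems {T}) (λ j → ∑ (elems {U}) (λ k → (A (i , j) * B (j , k)) * C (i , k))))
          ≡⟨ ∑-swap (elems {S}) (elems {T}) _ ⟩
        ∑ (elems {T}) (λ j → ∑ (elems {S}) (λ i → ∑ (elems {U}) (λ k → (A (i , j) * B (j , k)) * C (i , k))))
          ≡⟨ ∑-cong (elems {T}) (λ j → trans (∑-swap (elems {S}) (elems {U}) _)
               (∑-cong (elems {U}) (λ k → trans
                 (∑-cong (elems {S}) (λ i → trans (cong (_* C (i , k)) (*-comm _ _)) (*-assoc _ _ _)))
                 (∑-*ˡ (elems {S}) (B (j , k)) _)))) ⟩
        ∑ (elems {T}) (λ j → ∑ (elems {U}) (λ k → B (j , k) * ∑ (elems {S}) (λ i → A (i , j) * C (i , k))))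
          ≡⟨ ∑-cartesianProduct (elems {T}) (elems {U}) _ ⟨
        ⟨ B ∣ A ᵀ ⊗ C ⟩ ∎

  module _ {S T : Set} ⦃ finS : Finite S ⦄ ⦃ finT : Finite T ⦄ where

    ip-ᵀ : (A B : Mat S T) → ⟨ A ᵀ ∣ B ᵀ ⟩ ≡ ⟨ A ∣ B ⟩
    ip-ᵀ A B = trans (∑-cartesianProduct (elems {T}) (elems {S}) _)
      (trans (∑-swap (elems {T}) (elems {S}) _) (sym (∑-cartesianProduct (elems {S}) (elems {T}) _)))

  adjointʳ : {S T U : Set} ⦃ _ : Finite S ⦄ ⦃ _ : Finite T ⦄ ⦃ _ : Finite U ⦄
    (A : Mat S T) (B : Mat T U) (C : Mat S U) → ⟨ A ⊗ B ∣ C ⟩ ≡ ⟨ A ∣ C ⊗ B ᵀ ⟩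
  adjointʳ A B C = begin
    ⟨ A ⊗ B ∣ C ⟩             ≡⟨ ip-ᵀ (A ⊗ B) C ⟨
    ⟨ (A ⊗ B) ᵀ ∣ C ᵀ ⟩       ≡⟨ ip-cong (ᵀ-⊗ A B) ≈-refl ⟩
    ⟨ B ᵀ ⊗ A ᵀ ∣ C ᵀ ⟩       ≡⟨ adjointˡ (B ᵀ) (A ᵀ) (C ᵀ) ⟩
    ⟨ A ᵀ ∣ B ⊗ C ᵀ ⟩         ≡⟨ ip-cong {x = A ᵀ} ≈-refl (≈-sym (ᵀ-⊗ C (B ᵀ))) ⟩
    ⟨ A ᵀ ∣ (C ⊗ B ᵀ) ᵀ ⟩     ≡⟨ ip-ᵀ A (C ⊗ B ᵀ) ⟩
    ⟨ A ∣ C ⊗ B ᵀ ⟩           ∎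

  ⊗-assoc : {R S T U : Set} ⦃ _ : Finite S ⦄ ⦃ _ : Finite T ⦄
    (A : Mat R S) (B : Mat S T) (C : Mat T U) → (A ⊗ B) ⊗ C ≈ A ⊗ (B ⊗ C)
  ⊗-assoc {S = S} {T} A B C (i , l) = begin
    ∑ (elems {T}) (λ k → ∑ (elems {S}) (λ j → A (i , j) * B (j , k)) * C (k , l))
      ≡⟨ ∑-cong (elems {T}) (λ k → sym (∑-*ʳ (elems {S}) _ _)) ⟩
    ∑ (elems {T}) (λ k → ∑ (elems {S}) (λ j → (A (i , j) * B (j , k)) * C (k , l)))
      ≡⟨ ∑-swap (elems {T}) (elems {S}) _ ⟩
    ∑ (elems {S}) (λ j → ∑ (elems {T}) (λ k → (A (i , j) * B (j , k)) * C (k , l)))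
      ≡⟨ ∑-cong (elems {S}) (λ j → trans (∑-cong (elems {T}) (λ k → *-assoc _ _ _)) (∑-*ˡ (elems {T}) _ _)) ⟩
    ∑ (elems {S}) (λ j → A (i , j) * ∑ (elems {T}) (λ k → B (j , k) * C (k , l))) ∎

  module _ {S T : Set} where

    ⊗-oneˡ : ⦃ _ : Finite S ⦄ (A : Mat S T) → one ⊗ A ≈ A
    ⊗-oneˡ A (i , k) = ∑-δˡ i _

    ⊗-oneʳ : ⦃ _ : Finite T ⦄ (A : Mat S T) → A ⊗ one ≈ A
    ⊗-oneʳ A (i , k) = trans (∑-cong (elems {T}) (λ j → trans (*-comm _ _) (cong (_* A (i , j)) (δ-sym j k)))) (∑-δˡ k _)

  -- Commuting normal matrices and separating vectors

  module _ {S : Set} ⦃ fin : Finite S ⦄ where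

    one-ᵀ : one {S} ᵀ ≈ one
    one-ᵀ (i , j) = δ-sym j i

    Commute : Mat S S → Mat S S → Set
    Commute A B = A ⊗ B ≈ B ⊗ A

    commute-isSubspace : ∀ A → IsSubspace (Commute A)
    commute-isSubspace A = record
      { resp = λ e p → ≈-trans (⊗-cong {A = A} ≈-refl (≈-sym e)) (≈-trans p (⊗-cong e ≈-refl))
      ; origin = ≈-trans R.f-𝟘 (≈-sym L.f-𝟘)
      ; add = λ {x} {y} p q → ≈-trans (R.f-⊕ x y) (≈-trans (⊕-cong p q) (≈-sym (L.f-⊕ x y)))
      ; scale = λ c {x} p → ≈-trans (R.f-· c x) (≈-trans (·-cong c p) (≈-sym (L.f-· c x)))
      }
      where
      module R = IsLinear (⊗-isLinearʳ {U = S} A)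
      module L = IsLinear (⊗-isLinearˡ {S = S} A)

    commute-⊗ : ∀ {A B C} → Commute A B → Commute A C → Commute A (B ⊗ C)
    commute-⊗ {A} {B} {C} p q =
      ≈-trans (≈-sym (⊗-assoc A B C)) (≈-trans (⊗-cong p ≈-refl)
      (≈-trans (⊗-assoc B A C) (≈-trans (⊗-cong {A = B} ≈-refl q) (≈-sym (⊗-assoc B C A)))))

    commute-one : ∀ A → Commute A one
    commute-one A = ≈-trans (⊗-oneʳ A) (≈-sym (⊗-oneˡ A))

    commute-ᵀ : ∀ {A B} → Commute A B → Commute (A ᵀ) (B ᵀ)
    commute-ᵀ {A} {B} p = ≈-trans (≈-sym (ᵀ-⊗ B A)) (≈-trans (λ (i , j) → sym (p (j , i))) (ᵀ-⊗ A B))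

    -- Asking for `B ᵀ` as well makes normality the case `A = B`. The relation stays symmetric
    -- because transposing the second equation shows that `A ᵀ` commutes with `B`.
    StarCommute : Mat S S → Mat S S → Set
    StarCommute A B = Commute A B × Commute A (B ᵀ)

    starCommute-sym : ∀ {A B} → StarCommute A B → StarCommute B A
    starCommute-sym {A} {B} (p , q) = ≈-sym p , ≈-sym (commute-ᵀ q)

    starCommute-isSubspace : ∀ A → IsSubspace (StarCommute A)
    starCommute-isSubspace A = record
      { resp = λ e (p , q) → C.resp e p , C.resp (λ (i , j) → e (j , i)) q
      ; origin = C.origin , C.origin
      ; add = λ (p , q) (p′ , q′) → C.add p p′ , C.add q q′
      ; scale = λ c (p , q) → C.scale c p , C.scale c q
      }
      where module C = IsSubspace (commute-isSubspace A)

    Abelian : (Mat S S → Set) → Set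
    Abelian P = ∀ {A B} → P A → P B → StarCommute A B

    span-abelian : ∀ {P} → Abelian P → Abelian (Span P)
    span-abelian ab p q = span-least (starCommute-isSubspace _)
      (λ b → starCommute-sym (span-least (starCommute-isSubspace _) (λ a → starCommute-sym (ab a b)) p)) q

    -- A vector is a one-column matrix, so that associativity and adjointness of `_⊗_` also cover
    -- the action of matrices on vectors.
    Vector : Set
    Vector = Mat S ⊤

    -- For normal `A` the squared length of Aᵀv is ⟨v∣AAᵀv⟩ = ⟨v∣AᵀAv⟩.
    kernel-adjoint : ∀ {A : Mat S S} → Commute A (A ᵀ) → (v : Vector) → A ⊗ v ≈ 𝟘 → A ᵀ ⊗ v ≈ 𝟘
    kernel-adjoint {A} normal v e = ip-definite _ (begin
      ⟨ A ᵀ ⊗ v ∣ A ᵀ ⊗ v ⟩      ≡⟨ adjointˡ (A ᵀ) v _ ⟩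
      ⟨ v ∣ A ⊗ (A ᵀ ⊗ v) ⟩      ≡⟨ ip-cong {x = v} ≈-refl (≈-trans (≈-sym (⊗-assoc A (A ᵀ) v))
                                       (≈-trans (⊗-cong normal ≈-refl) (≈-trans (⊗-assoc (A ᵀ) A v)
                                       (≈-trans (⊗-cong {A = A ᵀ} ≈-refl e) (IsLinear.f-𝟘 (⊗-isLinearʳ (A ᵀ))))))) ⟩
      ⟨ v ∣ 𝟘 ⟩                  ≡⟨ ip-𝟘ʳ v ⟩
      0#                         ∎)

    -- A normal matrix has no nilpotent part: `A ⊗ v` lies in the kernel of `A`, hence in that of
    -- `A ᵀ`, and so is orthogonal to itself.
    normal-square-kernel : ∀ {A : Mat S S} → Commute A (A ᵀ) → (v : Vector) → A ⊗ (A ⊗ v) ≈ 𝟘 → A ⊗ v ≈ 𝟘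
    normal-square-kernel {A} normal v e = ip-definite _ (begin
      ⟨ A ⊗ v ∣ A ⊗ v ⟩          ≡⟨ adjointˡ A v _ ⟩
      ⟨ v ∣ A ᵀ ⊗ (A ⊗ v) ⟩      ≡⟨ ip-cong {x = v} ≈-refl (kernel-adjoint normal (A ⊗ v) e) ⟩
      ⟨ v ∣ 𝟘 ⟩                  ≡⟨ ip-𝟘ʳ v ⟩
      0#                         ∎)

    ≈𝟘-from-action : ∀ (A : Mat S S) → (∀ (v : Vector) → A ⊗ v ≈ 𝟘) → A ≈ 𝟘
    ≈𝟘-from-action A h (i , j) = trans
      (sym (trans (∑-cong (elems {S}) (λ k → *-comm _ _)) (∑-δˡ j (λ k → A (i , k)))))
      (h (λ (k , _) → δ j k) (i , tt))

    Separates : List (Mat S S) → Vector → Set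
    Separates L v = ∀ {A} → Span (_∈ L) A → A ⊗ v ≈ 𝟘 → A ≈ 𝟘

    -- This replaces simultaneous diagonalization. Let `v` separate `L`. If X v lies outside (span
    -- L) v, then `v` also separates X ∷ L. Otherwise X v = T v with `T` in the span, and Y = X - T
    -- kills `v`. If Y is nonzero, adding a vector u = Y w with Y u nonzero repairs this, and
    -- nothing cancels because R u and R v are orthogonal for every R in the span.
    separating-vector : ∀ L → Abelian (_∈ L) → ¬ ¬ ∃ (Separates L)
    separating-vector [] ab k = k (𝟘 , λ p _ → span-least zero-isSubspace (λ ()) p)
      where
      zero-isSubspace : IsSubspace {S × S} (_≈ 𝟘)
      zero-isSubspace = record
        { resp = λ e p → ≈-trans (≈-sym e) p
        ; origin = ≈-refl
        ; add = λ p q s → trans (cong₂ _+_ (p s) (q s)) (+-identityˡ 0#)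
        ; scale = λ c p s → trans (cong (c *_) (p s)) (zeroʳ c)
        }
    separating-vector (X ∷ L) ab k =
      separating-vector L (λ p q → ab (there p) (there q)) λ (v , sep) →
      ¬¬-excluded-middle {A = ∃ λ T → Span (_∈ L) T × X ⊗ v ≈ T ⊗ v} λ where
        (no none) → k (v , independent v sep none)
        (yes (T , T∈ , XT)) → dependent v sep T T∈ XT (≈𝟘? (X ⊖ T))
      where
      independent : ∀ v → Separates L v → ¬ (∃ λ T → Span (_∈ L) T × X ⊗ v ≈ T ⊗ v) → Separates (X ∷ L) v
      independent v sep none {R} R∈ Rv with T , c , T∈ , e ← span-∷ R∈ | c ≟ 0#
      ... | yes refl = ≈-trans R≈T (sep T∈ (≈-trans (⊗-cong (≈-sym R≈T) ≈-refl) Rv))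
        where
        R≈T : R ≈ T
        R≈T s = trans (e s) (trans (cong (T s +_) (zeroˡ (X s))) (+-identityʳ (T s)))
      ... | no c≢0 = ⊥-elim (none ((c ⁻¹) · ((- 1#) · T) , scale _ (scale _ T∈) , λ s → sym (begin
        (((c ⁻¹) · ((- 1#) · T)) ⊗ v) s       ≡⟨ LV.f-· (c ⁻¹) ((- 1#) · T) s ⟩
        (c ⁻¹) * (((- 1#) · T) ⊗ v) s         ≡⟨ cong ((c ⁻¹) *_) (LV.f-· (- 1#) T s) ⟩
        (c ⁻¹) * ((- 1#) * (T ⊗ v) s)         ≡⟨ cong ((c ⁻¹) *_) (vanish s) ⟨
        (c ⁻¹) * (c * (X ⊗ v) s)              ≡⟨ *-assoc _ _ _ ⟨
        ((c ⁻¹) * c) * (X ⊗ v) s              ≡⟨ cong (_* (X ⊗ v) s) (trans (*-comm _ _) (*-inverseʳ c c≢0)) ⟩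
        1# * (X ⊗ v) s                        ≡⟨ *-identityˡ _ ⟩
        (X ⊗ v) s                             ∎)))
        where
        module LV = IsLinear (⊗-isLinearˡ {S = S} v)
        vanish : ∀ s → c * (X ⊗ v) s ≡ (- 1#) * (T ⊗ v) s
        vanish s = trans (+-inverseʳ-unique _ _ (begin
          (T ⊗ v) s + c * (X ⊗ v) s   ≡⟨ cong ((T ⊗ v) s +_) (LV.f-· c X s) ⟨
          (T ⊗ v) s + ((c · X) ⊗ v) s ≡⟨ LV.f-⊕ T (c · X) s ⟨
          ((T ⊕ c · X) ⊗ v) s         ≡⟨ LV.f-cong e s ⟨
          (R ⊗ v) s                   ≡⟨ Rv s ⟩
          0#                          ∎)) (sym (-1*x≈-x _))
      dependent : ∀ v → Separates L v → ∀ T → Span (_∈ L) T → X ⊗ v ≈ T ⊗ v → Dec (X ⊖ T ≈ 𝟘) → ⊥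
      dependent v sep T T∈ XT (yes X⊖T≈𝟘) = k (v , λ {R} R∈ → sep (R∈L R∈))
        where
        R∈L : ∀ {R} → Span (_∈ (X ∷ L)) R → Span (_∈ L) R
        R∈L R∈ with T′ , c , T′∈ , e ← span-∷ R∈ =
          resp (≈-trans (⊕-cong ≈-refl (·-cong c (≈-sym (⊖≈𝟘⇒≈ X⊖T≈𝟘)))) (≈-sym e)) (add T′∈ (scale c T∈))
      dependent v sep T T∈ XT (no Y≉𝟘) =
        ¬¬-excluded-middle {A = ∃ λ w → ¬ Y ⊗ (Y ⊗ w) ≈ 𝟘} λ where
          -- A suitable `w` exists: were Y Y w always zero, normality would give Y w = 0 for all
          -- `w`, hence Y = 0.
          (no none) → Y≉𝟘 (≈𝟘-from-action Y (λ w → normal-square-kernel (proj₂ (ab′ Y∈ Y∈)) w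
            (decidable-stable (≈𝟘? _) (λ ne → none (w , ne)))))
          (yes (w , YYw≉𝟘)) → k (v ⊕ Y ⊗ w , separates w YYw≉𝟘)
        where
        Y : Mat S S
        Y = X ⊖ T
        Y∈ : Span (_∈ (X ∷ L)) Y
        Y∈ = add (gen (here refl)) (scale (- 1#) (span-mono there T∈))
        ab′ : Abelian (Span (_∈ (X ∷ L)))
        ab′ = span-abelian ab
        module LV = IsLinear (⊗-isLinearˡ {S = S} v)
        Yv : Y ⊗ v ≈ 𝟘
        Yv s = trans (LV.f-⊖ X T s) (≡⇒minus-zero (XT s))
        separates : ∀ w → ¬ Y ⊗ (Y ⊗ w) ≈ 𝟘 → Separates (X ∷ L) (v ⊕ Y ⊗ w)
        separates w YYw≉𝟘 {R} R∈ Ru with T′ , c , T′∈ , e ← span-∷ R∈ =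
          λ s → trans (R≈cY s) (trans (cong (_* Y s) c≡0) (zeroˡ _))
          where
          module RR = IsLinear (⊗-isLinearʳ {U = ⊤} R)
          u : Vector
          u = Y ⊗ w
          split : ∀ s → (R ⊗ v) s + (R ⊗ u) s ≡ 0#
          split s = trans (sym (RR.f-⊕ v u s)) (Ru s)
          -- `Y ᵀ` moves past `R ᵀ` and `R` and reaches `v`, which it kills because `Y` is normal
          -- and kills `v`. So R u and R v are orthogonal, and as their sum is zero, R v vanishes.
          swapped : Y ᵀ ⊗ (R ᵀ ⊗ (R ⊗ v)) ≈ 𝟘
          swapped =
            ≈-trans (≈-sym (⊗-assoc (Y ᵀ) (R ᵀ) (R ⊗ v)))
            (≈-trans (⊗-cong (commute-ᵀ {Y} {R} (proj₁ (ab′ Y∈ R∈))) ≈-refl)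
            (≈-trans (⊗-assoc (R ᵀ) (Y ᵀ) (R ⊗ v))
            (≈-trans (⊗-cong {A = R ᵀ} ≈-refl
              (≈-trans (≈-sym (⊗-assoc (Y ᵀ) R v))
              (≈-trans (⊗-cong (≈-sym (proj₂ (ab′ R∈ Y∈))) ≈-refl)
              (≈-trans (⊗-assoc R (Y ᵀ) v)
              (≈-trans (⊗-cong {A = R} ≈-refl (kernel-adjoint (proj₂ (ab′ Y∈ Y∈)) v Yv)) RR.f-𝟘)))))
            (IsLinear.f-𝟘 (⊗-isLinearʳ (R ᵀ))))))
          Ru⊥Rv : ⟨ R ⊗ u ∣ R ⊗ v ⟩ ≡ 0#
          Ru⊥Rv = begin
            ⟨ R ⊗ (Y ⊗ w) ∣ R ⊗ v ⟩        ≡⟨ adjointˡ R u _ ⟩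
            ⟨ Y ⊗ w ∣ R ᵀ ⊗ (R ⊗ v) ⟩      ≡⟨ adjointˡ Y w _ ⟩
            ⟨ w ∣ Y ᵀ ⊗ (R ᵀ ⊗ (R ⊗ v)) ⟩  ≡⟨ ip-cong {x = w} ≈-refl swapped ⟩
            ⟨ w ∣ 𝟘 ⟩                      ≡⟨ ip-𝟘ʳ w ⟩
            0#                             ∎
          Rv : R ⊗ v ≈ 𝟘
          Rv = ip-definite _ (begin
            ⟨ R ⊗ v ∣ R ⊗ v ⟩                      ≡⟨ +-identityʳ _ ⟨
            ⟨ R ⊗ v ∣ R ⊗ v ⟩ + 0#                 ≡⟨ cong (⟨ R ⊗ v ∣ R ⊗ v ⟩ +_) Ru⊥Rv ⟨
            ⟨ R ⊗ v ∣ R ⊗ v ⟩ + ⟨ R ⊗ u ∣ R ⊗ v ⟩  ≡⟨ ip-⊕ˡ (R ⊗ v) (R ⊗ u) (R ⊗ v) ⟨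
            ⟨ R ⊗ v ⊕ R ⊗ u ∣ R ⊗ v ⟩              ≡⟨ ip-cong split (≈-refl {x = R ⊗ v}) ⟩
            ⟨ 𝟘 ∣ R ⊗ v ⟩                          ≡⟨ ip-𝟘ˡ (R ⊗ v) ⟩
            0#                                     ∎)
          R₀ : Mat S S
          R₀ = T′ ⊕ c · T
          R≈ : R ≈ R₀ ⊕ c · Y
          R≈ s = begin
            R s                                          ≡⟨ e s ⟩
            T′ s + c * X s                               ≡⟨ cong (T′ s +_) (cong (c *_) (X≡ s)) ⟩
            T′ s + c * (T s + Y s)                       ≡⟨ cong (T′ s +_) (distribˡ c _ _) ⟩
            T′ s + (c * T s + c * Y s)                   ≡⟨ +-assoc _ _ _ ⟨
            (R₀ ⊕ c · Y) s                               ∎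
            where
            X≡ : ∀ s → X s ≡ T s + Y s
            X≡ s = begin
              X s                            ≡⟨ +-identityʳ _ ⟨
              X s + 0#                       ≡⟨ cong (X s +_) (≡⇒minus-zero {T s} refl) ⟨
              X s + (T s + (- 1#) * T s)     ≡⟨ +-assoc _ _ _ ⟨
              (X s + T s) + (- 1#) * T s     ≡⟨ cong (_+ (- 1#) * T s) (+-comm _ _) ⟩
              (T s + X s) + (- 1#) * T s     ≡⟨ +-assoc _ _ _ ⟩
              T s + Y s                      ∎
          -- Since `Y` kills `v`, so does `R₀`, and the separation of the span of `L` applies to it.
          -- What remains is R = c Y, and then R u = 0 with Y u nonzero forces c = 0.
          R₀≈𝟘 : R₀ ≈ 𝟘
          R₀≈𝟘 = sep (add T′∈ (scale c T∈)) (λ s → begin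
            (R₀ ⊗ v) s                         ≡⟨ +-identityʳ _ ⟨
            (R₀ ⊗ v) s + 0#                    ≡⟨ cong ((R₀ ⊗ v) s +_) (trans (cong (c *_) (Yv s)) (zeroʳ c)) ⟨
            (R₀ ⊗ v) s + c * (Y ⊗ v) s         ≡⟨ cong ((R₀ ⊗ v) s +_) (LV.f-· c Y s) ⟨
            (R₀ ⊗ v) s + ((c · Y) ⊗ v) s       ≡⟨ LV.f-⊕ R₀ (c · Y) s ⟨
            ((R₀ ⊕ c · Y) ⊗ v) s               ≡⟨ LV.f-cong R≈ s ⟨
            (R ⊗ v) s                          ≡⟨ Rv s ⟩
            0#                                 ∎)
          R≈cY : R ≈ c · Y
          R≈cY s = trans (R≈ s) (trans (cong (_+ c * Y s) (R₀≈𝟘 s)) (+-identityˡ _))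
          cYu : ∀ s → c * (Y ⊗ u) s ≡ 0#
          cYu s = begin
            c * (Y ⊗ u) s              ≡⟨ IsLinear.f-· (⊗-isLinearˡ {S = S} u) c Y s ⟨
            ((c · Y) ⊗ u) s            ≡⟨ ⊗-cong R≈cY (≈-refl {x = u}) s ⟨
            (R ⊗ u) s                  ≡⟨ +-identityˡ _ ⟨
            0# + (R ⊗ u) s             ≡⟨ cong (_+ (R ⊗ u) s) (Rv s) ⟨
            (R ⊗ v) s + (R ⊗ u) s      ≡⟨ split s ⟩
            0#                         ∎
          c≡0 : c ≡ 0#
          c≡0 with c ≟ 0#
          ... | yes c≡0 = c≡0
          ... | no c≢0 = ⊥-elim (YYw≉𝟘 (λ s → begin
            (Y ⊗ u) s                    ≡⟨ *-identityˡ _ ⟨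
            1# * (Y ⊗ u) s               ≡⟨ cong (_* (Y ⊗ u) s) (trans (*-comm _ _) (*-inverseʳ c c≢0)) ⟨
            ((c ⁻¹) * c) * (Y ⊗ u) s     ≡⟨ *-assoc _ _ _ ⟩
            (c ⁻¹) * (c * (Y ⊗ u) s)     ≡⟨ cong ((c ⁻¹) *_) (cYu s) ⟩
            (c ⁻¹) * 0#                  ≡⟨ zeroʳ _ ⟩
            0#                           ∎))

  module _ {S T : Set} where

    preimage-isSubspace : {f : V S → V T} → IsLinear f → {P : V T → Set} → IsSubspace P → IsSubspace (λ x → P (f x))
    preimage-isSubspace lin sub = record
      { resp = λ e → P.resp (f-cong e)
      ; origin = P.resp (≈-sym f-𝟘) P.origin
      ; add = λ {x} {y} p q → P.resp (≈-sym (f-⊕ x y)) (P.add p q)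
      ; scale = λ c {x} p → P.resp (≈-sym (f-· c x)) (P.scale c p)
      }
      where
      open IsLinear lin
      module P = IsSubspace sub

    linear-∑ : {f : V S → V T} → IsLinear f → {A : Set} (xs : List A) (x : A → V S) →
      f (λ s → ∑ xs (λ a → x a s)) ≈ (λ t → ∑ xs (λ a → f (x a) t))
    linear-∑ lin [] x = IsLinear.f-𝟘 lin
    linear-∑ lin (a ∷ xs) x t = trans (IsLinear.f-⊕ lin (x a) _ t) (cong (_ +_) (linear-∑ lin xs x t))

    equalizer-isSubspace : {f g : V S → V T} → IsLinear f → IsLinear g → IsSubspace (λ x → f x ≈ g x)
    equalizer-isSubspace lin lin′ = record
      { resp = λ e p → ≈-trans (F.f-cong (≈-sym e)) (≈-trans p (G.f-cong e))
      ; origin = ≈-trans F.f-𝟘 (≈-sym G.f-𝟘)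
      ; add = λ {x} {y} p q → ≈-trans (F.f-⊕ x y) (≈-trans (⊕-cong p q) (≈-sym (G.f-⊕ x y)))
      ; scale = λ c {x} p → ≈-trans (F.f-· c x) (≈-trans (·-cong c p) (≈-sym (G.f-· c x)))
      }
      where
      module F = IsLinear lin
      module G = IsLinear lin′

  ∘-isLinear : {R S T : Set} {g : V S → V T} {f : V R → V S} → IsLinear g → IsLinear f → IsLinear (λ x → g (f x))
  ∘-isLinear lin lin′ = record
    { f-cong = λ e → G.f-cong (F.f-cong e)
    ; f-⊕ = λ x y → ≈-trans (G.f-cong (F.f-⊕ x y)) (G.f-⊕ _ _)
    ; f-· = λ c x → ≈-trans (G.f-cong (F.f-· c x)) (G.f-· c _)
    }
    where
    module F = IsLinear lin′
    module G = IsLinear lin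

  id-isLinear : {S : Set} → IsLinear {S} (λ x → x)
  id-isLinear = record { f-cong = λ e → e ; f-⊕ = λ _ _ _ → refl ; f-· = λ _ _ _ → refl }

  ᵀ-isLinear : {S T : Set} → IsLinear {S × T} _ᵀ
  ᵀ-isLinear = record
    { f-cong = λ e (i , j) → e (j , i) ; f-⊕ = λ _ _ _ → refl ; f-· = λ _ _ _ → refl }

  module _ {S : Set} ⦃ fin : Finite S ⦄ where

    basis-unique : ∀ {P : V S → Set} {O} → IsSubspace P → Basis P O → ∀ {x p} → P p →
      (∀ {q} → P q → ⟨ x ∣ q ⟩ ≡ ⟨ p ∣ q ⟩) → p ≈ proj O x
    basis-unique {P} {O} sub basis {x} {p} p∈ h = ⊖≈𝟘⇒≈ (ip-definite _
      (trans (ip-⊖ˡ p (proj O x) d) (≡⇒minus-zero (trans (sym (h d∈))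
        (minus-zero⇒≡ (trans (sym (ip-⊖ˡ x (proj O x) d)) (residue-⊥ x d∈)))))))
      where
      open Basis basis
      d : V S
      d = p ⊖ proj O x
      d∈ : P d
      d∈ = IsSubspace.sub sub p∈ (proj-closed sub members x)

  -- Transpose-closed algebras and their maximal tori

  module _ {S : Set} ⦃ fin : Finite S ⦄ where

    record IsStarAlgebra (P : Mat S S → Set) : Set where
      field
        isSubspace : IsSubspace P
        mul : ∀ {A B} → P A → P B → P (A ⊗ B)
        unit : P one
        star : ∀ {A} → P A → P (A ᵀ)
      open IsSubspace isSubspace public

    Commutant : (Mat S S → Set) → Mat S S → Set
    Commutant P X = ∀ {A} → P A → Commute A X

    commutant-isStarAlgebra : ∀ {P} → (∀ {A} → P A → P (A ᵀ)) → IsStarAlgebra (Commutant P)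
    commutant-isStarAlgebra P-star = record
      { isSubspace = record
        { resp = λ e p a → C.resp _ e (p a)
        ; origin = λ a → C.origin _
        ; add = λ p q a → C.add _ (p a) (q a)
        ; scale = λ c p a → C.scale _ c (p a)
        }
      ; mul = λ {X} {Y} p q {A} a → commute-⊗ {A = A} {B = X} {C = Y} (p a) (q a)
      ; unit = λ {A} a → commute-one A
      ; star = λ {X} p {A} a → commute-ᵀ {A = A ᵀ} {B = X} (p (P-star a))
      }
      where module C (A : Mat S S) = IsSubspace (commute-isSubspace A)

    span-⊗ : ∀ {P Q : Mat S S → Set} → IsSubspace Q → (∀ {A B} → P A → P B → Q (A ⊗ B)) →
      ∀ {A B} → Span P A → Span P B → Q (A ⊗ B)
    span-⊗ sub f {A} {B} a b = span-least (preimage-isSubspace (⊗-isLinearˡ {S = S} B) sub)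
      (λ {A} a → span-least (preimage-isSubspace (⊗-isLinearʳ {U = S} A) sub) (f a) b) a

    -- The span is not itself required to be closed under transposition; `Abelian` already lets its
    -- members commute with each other's transposes. A torus can thus be enlarged by one matrix at a
    -- time.
    Torus : (Mat S S → Set) → List (Mat S S) → Set
    Torus P L = All P L × Orth L × Abelian (_∈ L)

    -- Evaluation at a separating vector embeds the span of the torus into the space of columns.
    torus-length : ∀ {P L} → Torus P L → length L ℕ.≤ card {S}
    torus-length {P} {L} (_ , orth , ab) = decidable-stable (length L ℕ.≤? card {S}) λ ne →
      separating-vector L ab λ (v , sep) → ne
        (subst (length L ℕ.≤_) (trans (card-× {S} {⊤}) (ℕ.*-identityʳ (card {S})))
          (orth-length-via (_⊗ v) (⊗-isLinearˡ {S = S} v) orth sep))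

    module _ {B : Mat S S → Set} (alg : IsStarAlgebra B) {L : List (Mat S S)} (torus : Torus B L)
      (max : ∀ {L′} → Torus B L′ → length L′ ℕ.≤ length L) where

      private
        module B = IsStarAlgebra alg
        L⊂B = proj₁ torus
        orth = proj₁ (proj₂ torus)
        ab : Abelian (_∈ L)
        ab = proj₂ (proj₂ torus)

      -- Otherwise the residue of `X` would lengthen the torus. Normality of `X` is what lets the
      -- residue commute with its own transpose.
      self-centralizing-normal : ∀ {X} → B X → Commute X (X ᵀ) → (∀ {M} → M ∈ L → StarCommute M X) → X ≈ proj L X
      self-centralizing-normal {X} X∈ normal comm with ≈-proj? L X
      ... | yes e = e
      ... | no ne = ⊥-elim (ℕ.<-irrefl refl (max
        (B.sub X∈ (proj-closed B.isSubspace L⊂B X) ∷ L⊂B , orth-extend orth X ne , λ p q → span-abelian ab′ (incl p) (incl q))))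
        where
        P′ : Mat S S → Set
        P′ A = A ∈ L ⊎ A ≡ X
        ab′ : Abelian P′
        ab′ (inj₁ p) (inj₁ q) = ab p q
        ab′ (inj₁ p) (inj₂ refl) = comm p
        ab′ (inj₂ refl) (inj₁ q) = starCommute-sym (comm q)
        ab′ (inj₂ refl) (inj₂ refl) = ≈-refl , normal
        incl : ∀ {A} → A ∈ ((X ⊖ proj L X) ∷ L) → Span P′ A
        incl (here refl) = IsSubspace.sub span-isSubspace (gen (inj₂ refl))
          (proj-closed span-isSubspace (All.tabulate (λ p → gen (inj₁ p))) X)
        incl (there p) = gen (inj₁ p)

      -- A general `X` need not be normal, but X + Xᵀ and X - Xᵀ are, since each is a multiple of
      -- its transpose; `X` is half their sum.
      self-centralizing : ∀ {X} → B X → (∀ {M} → M ∈ L → StarCommute M X) → X ≈ proj L X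
      self-centralizing {X} X∈ comm = Fix.resp halve (Fix.scale (2# ⁻¹) (Fix.add
        (self-centralizing-normal (B.add X∈ (B.star X∈))
          (≈-trans (⊗-cong {A = X ⊕ X ᵀ} ≈-refl sym-ᵀ) (⊗-cong (≈-sym sym-ᵀ) (≈-refl {x = X ⊕ X ᵀ})))
          (λ {M} m → SC.add M (comm m) (comm-ᵀ m)))
        (self-centralizing-normal (B.sub X∈ (B.star X∈))
          (commute-skew (X ⊖ X ᵀ) skew)
          (λ {M} m → SC.add M (comm m) (SC.scale M (- 1#) (comm-ᵀ m))))))
        where
        module Fix = IsSubspace (equalizer-isSubspace id-isLinear (proj-isLinear L))
        module SC (M : Mat S S) = IsSubspace (starCommute-isSubspace M)
        comm-ᵀ : ∀ {M} → M ∈ L → StarCommute M (X ᵀ)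
        comm-ᵀ m = proj₂ (comm m) , proj₁ (comm m)
        2# : F
        2# = fromℕ 2
        sym-ᵀ : (X ⊕ X ᵀ) ᵀ ≈ X ⊕ X ᵀ
        sym-ᵀ s = +-comm _ _
        skew : (X ⊖ X ᵀ) ᵀ ≈ (- 1#) · (X ⊖ X ᵀ)
        skew (i , j) = sym (begin
          (- 1#) * (X (i , j) + (- 1#) * X (j , i))               ≡⟨ distribˡ _ _ _ ⟩
          (- 1#) * X (i , j) + (- 1#) * ((- 1#) * X (j , i))      ≡⟨ +-comm _ _ ⟩
          (- 1#) * ((- 1#) * X (j , i)) + (- 1#) * X (i , j)      ≡⟨ cong (_+ (- 1#) * X (i , j)) (minus-minus (X (j , i))) ⟩
          X (j , i) + (- 1#) * X (i , j)                          ∎)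
          where
          minus-minus : ∀ a → (- 1#) * ((- 1#) * a) ≡ a
          minus-minus a = minus-zero⇒≡ (trans (sym (distribˡ (- 1#) _ a)) (trans
            (cong ((- 1#) *_) (trans (+-comm _ a) (≡⇒minus-zero refl))) (zeroʳ _)))
        commute-skew : ∀ (Y : Mat S S) {c} → Y ᵀ ≈ c · Y → Commute Y (Y ᵀ)
        commute-skew Y {c} e = IsSubspace.resp (commute-isSubspace Y) (≈-sym e)
          (IsSubspace.scale (commute-isSubspace Y) c ≈-refl)
        halve : (2# ⁻¹) · ((X ⊕ X ᵀ) ⊕ (X ⊖ X ᵀ)) ≈ X
        halve (i , j) = begin
          (2# ⁻¹) * ((a + b) + (a + (- 1#) * b))   ≡⟨ cong ((2# ⁻¹) *_) (+-interchange a b a _) ⟩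
          (2# ⁻¹) * ((a + a) + (b + (- 1#) * b))   ≡⟨ cong (λ z → (2# ⁻¹) * ((a + a) + z)) (≡⇒minus-zero refl) ⟩
          (2# ⁻¹) * ((a + a) + 0#)                 ≡⟨ cong ((2# ⁻¹) *_) (+-identityʳ _) ⟩
          (2# ⁻¹) * (a + a)                        ≡⟨ cong ((2# ⁻¹) *_) (double a) ⟨
          (2# ⁻¹) * (2# * a)                       ≡⟨ *-assoc _ _ _ ⟨
          ((2# ⁻¹) * 2#) * a                       ≡⟨ cong (_* a) (trans (*-comm _ _) (*-inverseʳ 2# (fromℕ-suc≢0 1))) ⟩
          1# * a                                   ≡⟨ *-identityˡ a ⟩
          a                                        ∎
          where
          a b : F
          a = X (i , j)
          b = X (j , i)
          double : ∀ a → 2# * a ≡ a + a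
          double a = trans (distribʳ a _ _) (cong₂ _+_ (*-identityˡ a)
            (trans (cong (_* a) (+-identityʳ 1#)) (*-identityˡ a)))

    -- The double commutant theorem

    matrixUnit : S → S → Mat S S
    matrixUnit j c (k , l) = δ j k * δ c l

    ⊗-matrixUnit : ∀ X j c → X ⊗ matrixUnit j c ≈ (λ s → ∑ₛ (λ k → (X (k , j) · matrixUnit k c) s))
    ⊗-matrixUnit X j c (i , l) = begin
      ∑ₛ (λ k → X (i , k) * (δ j k * δ c l))   ≡⟨ ∑-cong (elems {S}) (λ k → *-leftComm _ _ _) ⟩
      ∑ₛ (λ k → δ j k * (X (i , k) * δ c l))   ≡⟨ ∑-δˡ j _ ⟩
      X (i , j) * δ c l                        ≡⟨ ∑-δˡ i (λ k → X (k , j) * δ c l) ⟨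
      ∑ₛ (λ k → δ i k * (X (k , j) * δ c l))   ≡⟨ ∑-cong (elems {S}) (λ k → trans (*-leftComm _ _ _)
                                                    (cong (λ z → X (k , j) * (z * δ c l)) (δ-sym i k))) ⟩
      ∑ₛ (λ k → X (k , j) * (δ k i * δ c l))   ∎

    one-matrixUnits : one ≈ (λ s → ∑ₛ (λ j → matrixUnit j j s))
    one-matrixUnits (k , l) = sym (trans (∑-cong (elems {S}) (λ j → cong (_* δ j l) (δ-sym j k))) (∑-δˡ k (λ j → δ j l)))

    module _ {A : Mat S S → Set} (alg : IsStarAlgebra A) {O : List (Mat S S)} (basis : Basis A O) where

      private
        module A = IsStarAlgebra alg
        open Basis basis

        -- Reading a matrix as the family of its columns makes the projection a block operator, and
        -- `block b c` is the part that sends column `c` to column `b`. Left multiplication acts on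
        -- all columns alike, so commuting with it is tested block by block.
        block : S → S → Mat S S
        block b c (i , j) = proj O (matrixUnit j c) (i , b)

        block-⊗ : ∀ X j c i b → proj O (X ⊗ matrixUnit j c) (i , b) ≡ (block b c ⊗ X) (i , j)
        block-⊗ X j c i b = begin
          proj O (X ⊗ matrixUnit j c) (i , b)                            ≡⟨ P.f-cong (⊗-matrixUnit X j c) (i , b) ⟩
          proj O (λ s → ∑ₛ (λ k → (X (k , j) · matrixUnit k c) s)) (i , b) ≡⟨ linear-∑ (proj-isLinear O) (elems {S}) _ (i , b) ⟩
          ∑ₛ (λ k → proj O (X (k , j) · matrixUnit k c) (i , b))         ≡⟨ ∑-cong (elems {S}) (λ k → trans (P.f-· _ _ (i , b)) (*-comm _ _)) ⟩
          (block b c ⊗ X) (i , j)                                        ∎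
          where module P = IsLinear (proj-isLinear O)

        -- Both sides lie in `A` and have the same inner product with every Q in `A`, because XᵀQ is
        -- again in `A`.
        proj-module : ∀ {X} → A X → ∀ Y → X ⊗ proj O Y ≈ proj O (X ⊗ Y)
        proj-module {X} X∈ Y = basis-unique A.isSubspace basis (A.mul X∈ (proj-closed A.isSubspace members Y)) λ {Q} Q∈ → begin
          ⟨ X ⊗ Y ∣ Q ⟩           ≡⟨ adjointˡ X Y Q ⟩
          ⟨ Y ∣ X ᵀ ⊗ Q ⟩         ≡⟨ minus-zero⇒≡ (trans (sym (ip-⊖ˡ Y (proj O Y) _)) (residue-⊥ Y (A.mul (A.star X∈) Q∈))) ⟩
          ⟨ proj O Y ∣ X ᵀ ⊗ Q ⟩  ≡⟨ adjointˡ X (proj O Y) Q ⟨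
          ⟨ X ⊗ proj O Y ∣ Q ⟩    ∎

        block∈ : ∀ b c → Commutant A (block b c)
        block∈ b c {X} X∈ (i , j) = trans (proj-module X∈ (matrixUnit j c) (i , b)) (block-⊗ X j c i b)

      -- The blocks of the orthogonal projection onto A commute with A, because the projection is left
      -- A-linear.  Hence it is linear over the double commutant, and fixes X = X · 1.
      double-commutant : ∀ {X} → Commutant (Commutant A) X → A X
      double-commutant {X} X∈ = A.resp (≈-sym fixed) (proj-closed A.isSubspace members X)
        where
        on-units : ∀ j c → X ⊗ proj O (matrixUnit j c) ≈ proj O (X ⊗ matrixUnit j c)
        on-units j c (i , b) = trans (sym (X∈ (block∈ b c) (i , j))) (sym (block-⊗ X j c i b))
        left right : IsLinear {S × S} _
        left = ∘-isLinear (⊗-isLinearʳ {U = S} X) (proj-isLinear O)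
        right = ∘-isLinear (proj-isLinear O) (⊗-isLinearʳ {U = S} X)
        fixed : X ≈ proj O X
        fixed s = begin
          X s                                                   ≡⟨ ⊗-oneʳ X s ⟨
          (X ⊗ one) s                                           ≡⟨ ⊗-cong {A = X} ≈-refl (spans A.unit) s ⟩
          (X ⊗ proj O one) s                                    ≡⟨ IsLinear.f-cong left one-matrixUnits s ⟩
          (X ⊗ proj O (λ s → ∑ₛ (λ j → matrixUnit j j s))) s    ≡⟨ linear-∑ left (elems {S}) _ s ⟩
          ∑ₛ (λ j → (X ⊗ proj O (matrixUnit j j)) s)            ≡⟨ ∑-cong (elems {S}) (λ j → on-units j j s) ⟩
          ∑ₛ (λ j → proj O (X ⊗ matrixUnit j j) s)              ≡⟨ linear-∑ right (elems {S}) _ s ⟨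
          proj O (X ⊗ (λ s → ∑ₛ (λ j → matrixUnit j j s))) s    ≡⟨ IsLinear.f-cong right one-matrixUnits s ⟨
          proj O (X ⊗ one) s                                    ≡⟨ IsLinear.f-cong (proj-isLinear O) (⊗-oneʳ X) s ⟩
          proj O X s                                            ∎

  module _ {S : Set} ⦃ fin : Finite S ⦄ where

    -- Chains of transpose-closed algebras

    _⊑_ : (Mat S S → Set) → (Mat S S → Set) → Set
    P ⊑ Q = ∀ {X} → P X → Q X

    module _ {A B : Mat S S → Set} (algA : IsStarAlgebra A) (algB : IsStarAlgebra B) (A⊑B : A ⊑ B) where

      private
        A′ B′ : Mat S S → Set
        A′ = Commutant A
        B′ = Commutant B
        module A = IsStarAlgebra algA
        module B = IsStarAlgebra algB
        algA′ : IsStarAlgebra A′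
        algA′ = commutant-isStarAlgebra A.star
        algB′ : IsStarAlgebra B′
        algB′ = commutant-isStarAlgebra B.star
        module A′ = IsStarAlgebra algA′
        module B′ = IsStarAlgebra algB′
        B′⊑A′ : B′ ⊑ A′
        B′⊑A′ y a = y (A⊑B a)

      -- T is the span of L, a maximal torus of both A and B; G = T B′ contains A′ because the commutant
      -- of G is T.  What remains of A′ beyond B′ is orthogonal to G: the projection of t ∈ T to A′ is
      -- central in A′, hence lies in the maximal torus K of A′ and so in B′.
      equal-tori⇒⊒ : ∀ {L K} → Torus A L → (∀ {L′} → Torus B L′ → length L′ ℕ.≤ length L) →
        Torus B′ K → (∀ {K′} → Torus A′ K′ → length K′ ℕ.≤ length K) → ¬ ¬ (B ⊑ A)
      equal-tori⇒⊒ {L} {K} (L⊂A , orthL , abL) maxL (K⊂B′ , orthK , abK) maxK k =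
        exists-basis A.isSubspace λ (_ , basisA) →
        exists-basis B.isSubspace λ (_ , basisB) →
        exists-basis A′.isSubspace λ (_ , basisA′) →
        exists-basis B′.isSubspace λ (_ , basisB′) →
        exists-basis algG.isSubspace λ (_ , basisG) →
        k (conclude basisA basisB basisA′ basisB′ basisG)
        where
        T : Mat S S → Set
        T X = B X × (∀ {M} → M ∈ L → StarCommute M X)

        -- Equality of the ranks of `A` and `B` enters here: it makes `L` maximal in `B`, so that
        -- its centralizer in `B` is its own span.
        T⊑A : T ⊑ A
        T⊑A {X} (X∈ , comm) = A.resp (≈-sym (self-centralizing algB (All.map A⊑B L⊂A , orthL , abL) maxL X∈ comm))
          (proj-closed A.isSubspace L⊂A X)

        T-star : ∀ {X} → T X → T (X ᵀ)
        T-star (X∈ , comm) = B.star X∈ , λ m → proj₂ (comm m) , proj₁ (comm m)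

        T-mul : ∀ {X Y} → T X → T Y → T (X ⊗ Y)
        T-mul {X} {Y} (X∈ , c) (Y∈ , d) = B.mul X∈ Y∈ , λ {M} m →
          commute-⊗ {A = M} {B = X} {C = Y} (proj₁ (c m)) (proj₁ (d m)) ,
          IsSubspace.resp (commute-isSubspace M) (≈-sym (ᵀ-⊗ X Y))
            (commute-⊗ {A = M} {B = Y ᵀ} {C = X ᵀ} (proj₂ (d m)) (proj₂ (c m)))

        T-unit : T one
        T-unit = B.unit , λ {M} m → commute-one M , IsSubspace.resp (commute-isSubspace M) (≈-sym one-ᵀ) (commute-one M)

        L⊂T : ∀ {M} → M ∈ L → T M
        L⊂T m = A⊑B (All.lookup L⊂A m) , λ m′ → abL m′ m

        Products : Mat S S → Set
        Products Z = ∃ λ X → ∃ λ Y → T X × B′ Y × Z ≈ X ⊗ Y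

        G : Mat S S → Set
        G = Span Products

        T⊑G : T ⊑ G
        T⊑G {X} x = gen (X , one , x , B′.unit , ≈-sym (⊗-oneʳ X))

        B′⊑G : B′ ⊑ G
        B′⊑G {Y} y = gen (one , Y , T-unit , y , ≈-sym (⊗-oneˡ Y))

        -- Members of `T` lie in `B` and so commute with those of `B′`; this regroups a product of
        -- products and reverses a transposed one.
        algG : IsStarAlgebra G
        algG = record
          { isSubspace = span-isSubspace
          ; mul = span-⊗ span-isSubspace λ (X , Y , x , y , e) (X′ , Y′ , x′ , y′ , e′) →
              gen (X ⊗ X′ , Y ⊗ Y′ , T-mul x x′ , B′.mul y y′ , ≈-trans (⊗-cong e e′) (exchange X Y X′ Y′ (y (proj₁ x′))))
          ; unit = T⊑G T-unit
          ; star = span-least (preimage-isSubspace ᵀ-isLinear span-isSubspace) λ (X , Y , x , y , e) →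
              gen (X ᵀ , Y ᵀ , T-star x , B′.star y ,
                ≈-trans (IsLinear.f-cong ᵀ-isLinear e) (≈-trans (ᵀ-⊗ X Y) (≈-sym (B′.star y (proj₁ (T-star x))))))
          }
          where
          exchange : ∀ X Y X′ Y′ → Commute X′ Y → (X ⊗ Y) ⊗ (X′ ⊗ Y′) ≈ (X ⊗ X′) ⊗ (Y ⊗ Y′)
          exchange X Y X′ Y′ c = ≈-trans (⊗-assoc X Y (X′ ⊗ Y′)) (≈-trans (⊗-cong {A = X} ≈-refl
            (≈-trans (≈-sym (⊗-assoc Y X′ Y′)) (≈-trans (⊗-cong (≈-sym c) (≈-refl {x = Y′})) (⊗-assoc X′ Y Y′))))
            (≈-sym (⊗-assoc X X′ (Y ⊗ Y′))))

        module algG = IsStarAlgebra algG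

        module _ {OA OB OA′ OB′ OG : List (Mat S S)} (basisA : Basis A OA) (basisB : Basis B OB)
          (basisA′ : Basis A′ OA′) (basisB′ : Basis B′ OB′) (basisG : Basis G OG) where

          G′⊑T : Commutant G ⊑ T
          G′⊑T {Y} y = double-commutant algB basisB (λ c → y (B′⊑G c)) , λ {M} m →
            y (T⊑G (L⊂T m)) , commute-ᵀ {A = M ᵀ} {B = Y} (y (T⊑G (T-star (L⊂T m))))

          A′⊑G : A′ ⊑ G
          A′⊑G m = double-commutant algG basisG (λ y → m (T⊑A (G′⊑T y)))

          -- `X` lies in `A` and commutes with `U`. Multiplication by `U` on either side has adjoint
          -- multiplication by `U ᵀ`, which preserves `A′`, so commutation survives the projection.
          projection-central : ∀ {X} → T X → Commutant A′ (proj OA′ X)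
          projection-central {X} x {U} u = ⊖≈𝟘⇒≈ (ip-definite _ (trans (ip-⊖ˡ (U ⊗ E) (E ⊗ U) D) (≡⇒minus-zero (begin
            ⟨ U ⊗ E ∣ D ⟩      ≡⟨ adjointˡ U E D ⟩
            ⟨ E ∣ U ᵀ ⊗ D ⟩    ≡⟨ same (A′.mul (A′.star u) D∈) ⟨
            ⟨ X ∣ U ᵀ ⊗ D ⟩    ≡⟨ adjointˡ U X D ⟨
            ⟨ U ⊗ X ∣ D ⟩      ≡⟨ ip-cong (≈-sym (u (T⊑A x))) (≈-refl {x = D}) ⟩
            ⟨ X ⊗ U ∣ D ⟩      ≡⟨ adjointʳ X U D ⟩
            ⟨ X ∣ D ⊗ U ᵀ ⟩    ≡⟨ same (A′.mul D∈ (A′.star u)) ⟩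
            ⟨ E ∣ D ⊗ U ᵀ ⟩    ≡⟨ adjointʳ E U D ⟨
            ⟨ E ⊗ U ∣ D ⟩      ∎))))
            where
            E D : Mat S S
            E = proj OA′ X
            D = U ⊗ E ⊖ E ⊗ U
            E∈ : A′ E
            E∈ = proj-closed A′.isSubspace (Basis.members basisA′) X
            D∈ : A′ D
            D∈ = A′.sub (A′.mul u E∈) (A′.mul E∈ u)
            same : ∀ {Q} → A′ Q → ⟨ X ∣ Q ⟩ ≡ ⟨ E ∣ Q ⟩
            same {Q} q = minus-zero⇒≡ (trans (sym (ip-⊖ˡ X E Q)) (Basis.residue-⊥ basisA′ X q))

          -- Equality of the ranks of the commutants enters here: `maxK` makes `K`, a torus of `B′`,
          -- maximal even in `A′`.
          projection∈B′ : ∀ {X} → T X → B′ (proj OA′ X)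
          projection∈B′ {X} x = B′.resp (≈-sym (self-centralizing algA′ (All.map B′⊑A′ K⊂B′ , orthK , abK) maxK
              (proj-closed A′.isSubspace (Basis.members basisA′) X)
              (λ {M} m → central (K⊂A′ m) , commute-ᵀ {A = M ᵀ} {B = proj OA′ X} (central (A′.star (K⊂A′ m))))))
            (proj-closed B′.isSubspace K⊂B′ (proj OA′ X))
            where
            central : Commutant A′ (proj OA′ X)
            central = projection-central x
            K⊂A′ : ∀ {M} → M ∈ K → A′ M
            K⊂A′ m = B′⊑A′ (All.lookup K⊂B′ m)

          T⊥ : ∀ {X M} → T X → A′ M → (∀ {Y} → B′ Y → ⟨ M ∣ Y ⟩ ≡ 0#) → ⟨ X ∣ M ⟩ ≡ 0#
          T⊥ {X} {M} x m M⊥B′ = begin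
            ⟨ X ∣ M ⟩             ≡⟨ minus-zero⇒≡ (trans (sym (ip-⊖ˡ X _ M)) (Basis.residue-⊥ basisA′ X m)) ⟩
            ⟨ proj OA′ X ∣ M ⟩    ≡⟨ ip-comm _ M ⟩
            ⟨ M ∣ proj OA′ X ⟩    ≡⟨ M⊥B′ (projection∈B′ x) ⟩
            0#                    ∎

          -- In ⟨X Y∣M⟩ the factor `Y` moves to the other side, and M Yᵀ is again a member of `A′`
          -- orthogonal to `B′`. Only the case of `X` alone remains.
          G⊥ : ∀ {M} → A′ M → (∀ {Y} → B′ Y → ⟨ M ∣ Y ⟩ ≡ 0#) → ∀ {Z} → G Z → ⟨ M ∣ Z ⟩ ≡ 0#
          G⊥ {M} m M⊥B′ = span-least (perp-isSubspace M) λ {Z} (X , Y , x , y , e) → begin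
            ⟨ M ∣ Z ⟩              ≡⟨ ip-cong {x = M} ≈-refl e ⟩
            ⟨ M ∣ X ⊗ Y ⟩          ≡⟨ ip-comm M _ ⟩
            ⟨ X ⊗ Y ∣ M ⟩          ≡⟨ adjointʳ X Y M ⟩
            ⟨ X ∣ M ⊗ Y ᵀ ⟩        ≡⟨ T⊥ x (A′.mul m (B′⊑A′ (B′.star y)))
                                       (λ {W} w → trans (adjointʳ M (Y ᵀ) W) (M⊥B′ (B′.mul w y))) ⟩
            0#                     ∎

          -- The residue of `M` belongs to `G` and is orthogonal to `G`, hence to itself.
          A′⊑B′ : A′ ⊑ B′
          A′⊑B′ {M} m = B′.resp (≈-sym (⊖≈𝟘⇒≈ (ip-definite _ (G⊥ r (Basis.residue-⊥ basisB′ M) (A′⊑G r)))))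
            (proj-closed B′.isSubspace (Basis.members basisB′) M)
            where
            r : A′ (M ⊖ proj OB′ M)
            r = A′.sub m (B′⊑A′ (proj-closed B′.isSubspace (Basis.members basisB′) M))

          conclude : B ⊑ A
          conclude b = double-commutant algA basisA (λ y → ≈-sym (A′⊑B′ y b))

    -- A relation rather than a function, since a largest torus is only obtained under a double
    -- negation.
    HasRank : (Mat S S → Set) → ℕ → Set
    HasRank P d = (∃ λ L → Torus P L × length L ≡ d) × (∀ {L} → Torus P L → length L ℕ.≤ d)

    exists-rank : ∀ P → ¬ ¬ ∃ (HasRank P)
    exists-rank P k = maximal (Torus P) (card {S}) ([] , tt , λ ()) torus-length λ (L , t , max) →
      k (length L , (L , t , refl) , max)

    rank-mono : ∀ {P Q a b} → P ⊑ Q → HasRank P a → HasRank Q b → a ℕ.≤ b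
    rank-mono P⊑Q ((L , (p , o , ab) , refl) , _) (_ , max) = max (All.map P⊑Q p , o , ab)

    -- The conclusion says a - a′ < b - b′ without subtraction. Both ranks are monotone, so equality
    -- would force a = b and a′ = b′, and then the algebras would coincide.
    rank-step : ∀ {A B a a′ b b′} → IsStarAlgebra A → IsStarAlgebra B → A ⊑ B → ¬ (B ⊑ A) →
      HasRank A a → HasRank (Commutant A) a′ → HasRank B b → HasRank (Commutant B) b′ → a ℕ.+ b′ ℕ.< b ℕ.+ a′
    rank-step {a = a} {a′} {b} {b′} algA algB A⊑B B⋢A rA rA′ rB rB′ = ℕ.≤∧≢⇒<
      (ℕ.+-mono-≤ a≤b b′≤a′) λ e → equal (ℕ.≤-antisym a≤b (ℕ.≮⇒≥ λ lt → ℕ.<-irrefl e (ℕ.+-mono-<-≤ lt b′≤a′)))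
                                        (ℕ.≤-antisym b′≤a′ (ℕ.≮⇒≥ λ lt → ℕ.<-irrefl e (ℕ.+-mono-≤-< a≤b lt))) rA rB rA′ rB′
      where
      a≤b : a ℕ.≤ b
      a≤b = rank-mono A⊑B rA rB
      b′≤a′ : b′ ℕ.≤ a′
      b′≤a′ = rank-mono (λ y {X} x → y (A⊑B x)) rB′ rA′
      equal : a ≡ b → b′ ≡ a′ → HasRank _ a → HasRank _ b → HasRank _ a′ → HasRank _ b′ → ⊥
      equal refl refl ((L , tL , refl) , _) (_ , maxB) (_ , maxA′) ((K , tK , refl) , _) =
        equal-tori⇒⊒ algA algB A⊑B tL maxB tK maxA′ B⋢A

    rank≤card : ∀ {P a} → HasRank P a → a ℕ.≤ card {S}
    rank≤card ((_ , t , refl) , _) = torus-length t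

    -- Along a strictly increasing chain, rank P − rank P′ grows by at least one at every step.
    chain-length : (𝒜 : ℕ → Mat S S → Set) (q : ℕ) → S → (∀ i → i ℕ.≤ q → IsStarAlgebra (𝒜 i)) →
      (∀ i → i ℕ.< q → 𝒜 i ⊑ 𝒜 (suc i)) → (∀ i → i ℕ.< q → ¬ (𝒜 (suc i) ⊑ 𝒜 i)) → q ℕ.< 2 ℕ.* card {S}
    chain-length 𝒜 q s alg incl strict = decidable-stable (q ℕ.<? _) λ ne →
      go q ℕ.≤-refl λ (a , a′ , rA , rA′ , le) → ne (ℕ.≤-trans (ℕ.m≤m+n (suc q) a′) (ℕ.≤-trans le
        (ℕ.≤-trans (ℕ.+-monoˡ-≤ N (rank≤card rA)) (ℕ.≤-reflexive (cong (N ℕ.+_) (sym (ℕ.+-identityʳ N)))))))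
      where
      N : ℕ
      N = card {S}
      one≉𝟘 : ¬ one {S} ≈ 𝟘
      one≉𝟘 e = 1≢0 (trans (sym (δ-same s)) (e (s , s)))
      go : ∀ i → i ℕ.≤ q → ¬ ¬ ∃ λ a → ∃ λ a′ → HasRank (𝒜 i) a × HasRank (Commutant (𝒜 i)) a′ × suc i ℕ.+ a′ ℕ.≤ a ℕ.+ N
      -- The initial 1 is the rank contributed by `one`, which is nonzero because `S` has a point.
      -- Together with the bound N on the rank of the commutant it makes the final inequality
      -- strict.
      go zero le k = exists-rank (𝒜 0) λ (a , rA) → exists-rank (Commutant (𝒜 0)) λ (a′ , rA′) →
        k (a , a′ , rA , rA′ , ℕ.+-mono-≤
          (proj₂ rA {one ∷ []} (IsStarAlgebra.unit (alg 0 le) ∷ [] , (one≉𝟘 , [] , tt) , λ where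
            (here refl) (here refl) → ≈-refl ,
              IsSubspace.resp (commute-isSubspace one) (≈-sym one-ᵀ) ≈-refl))
          (rank≤card rA′))
      go (suc i) le k = go i (ℕ.<⇒≤ le) λ (a , a′ , rA , rA′ , bound) →
        exists-rank (𝒜 (suc i)) λ (b , rB) → exists-rank (Commutant (𝒜 (suc i))) λ (b′ , rB′) →
        k (b , b′ , rB , rB′ , arithmetic
          (rank-step (alg i (ℕ.<⇒≤ le)) (alg (suc i) le) (incl i le) (strict i le) rA rA′ rB rB′) bound)
        where
        arithmetic : ∀ {a a′ b b′} → a ℕ.+ b′ ℕ.< b ℕ.+ a′ → suc i ℕ.+ a′ ℕ.≤ a ℕ.+ N → suc (suc i) ℕ.+ b′ ℕ.≤ b ℕ.+ N
        arithmetic {a} {a′} {b} {b′} p q = ℕ.+-cancelʳ-≤ (a ℕ.+ a′) _ _ (subst₂ ℕ._≤_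
          (solve 4 (λ i a a′ b′ → (con 1 :+ (a :+ b′)) :+ ((con 1 :+ i) :+ a′) := (con 2 :+ i :+ b′) :+ (a :+ a′)) refl i a a′ b′)
          (solve 4 (λ a a′ b N → (b :+ a′) :+ (a :+ N) := (b :+ N) :+ (a :+ a′)) refl a a′ b N)
          (ℕ.+-mono-≤ p q))

  module _ {S : Set} ⦃ fin : Finite S ⦄ where

    -- Generated algebras

    ∏ : List (Mat S S) → Mat S S
    ∏ [] = one
    ∏ (X ∷ Xs) = X ⊗ ∏ Xs

    ∏-++ : ∀ Xs Ys → ∏ (Xs ++ Ys) ≈ ∏ Xs ⊗ ∏ Ys
    ∏-++ [] Ys = ≈-sym (⊗-oneˡ (∏ Ys))
    ∏-++ (X ∷ Xs) Ys = ≈-trans (⊗-cong {A = X} ≈-refl (∏-++ Xs Ys)) (≈-sym (⊗-assoc X (∏ Xs) (∏ Ys)))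

    Words≤ : ℕ → (Mat S S → Set) → Mat S S → Set
    Words≤ m P = Span (λ X → ∃ λ Xs → All P Xs × length Xs ℕ.≤ m × X ≈ ∏ Xs)

    Generated : (Mat S S → Set) → Mat S S → Set
    Generated P = Span (λ X → ∃ λ Xs → All P Xs × X ≈ ∏ Xs)

    ⊑-generated : ∀ {P} → P ⊑ Generated P
    ⊑-generated {P} {X} p = gen (X ∷ [] , p ∷ [] , ≈-sym (⊗-oneʳ X))

    generated-mono : ∀ {P Q} → P ⊑ Q → Generated P ⊑ Generated Q
    generated-mono P⊑Q = span-mono (λ (Xs , p , e) → Xs , All.map P⊑Q p , e)

    generated-isStarAlgebra : ∀ {P} → (∀ {X} → P X → P (X ᵀ)) → IsStarAlgebra (Generated P)
    generated-isStarAlgebra {P} P-star = record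
      { isSubspace = span-isSubspace
      ; mul = mul
      ; unit = unit
      ; star = span-least (preimage-isSubspace ᵀ-isLinear span-isSubspace)
          λ (Xs , p , e) → resp (≈-sym (IsLinear.f-cong ᵀ-isLinear e)) (∏-star Xs p)
      }
      where
      mul : ∀ {X Y} → Generated P X → Generated P Y → Generated P (X ⊗ Y)
      mul = span-⊗ span-isSubspace λ (Xs , p , e) (Ys , q , e′) →
        gen (Xs ++ Ys , ++⁺ p q , ≈-trans (⊗-cong e e′) (≈-sym (∏-++ Xs Ys)))
      unit : Generated P one
      unit = gen ([] , [] , ≈-refl)
      ∏-star : ∀ Xs → All P Xs → Generated P (∏ Xs ᵀ)
      ∏-star [] [] = resp (≈-sym one-ᵀ) unit
      ∏-star (X ∷ Xs) (p ∷ ps) = resp (≈-sym (ᵀ-⊗ X (∏ Xs))) (mul (∏-star Xs ps) (⊑-generated (P-star p)))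

    words-mono : ∀ {P m m′} → m ℕ.≤ m′ → Words≤ m P ⊑ Words≤ m′ P
    words-mono le = span-mono (λ (Xs , p , l , e) → Xs , p , ℕ.≤-trans l le , e)

    -- Prepending a letter sends the span of words of length at most `m` into that of length at most
    -- m + 1, hence back into itself; so it absorbs every word, letter by letter.
    words-stable : ∀ {P} m → Words≤ (suc m) P ⊑ Words≤ m P → Generated P ⊑ Words≤ m P
    words-stable {P} m stable = span-least span-isSubspace λ (Xs , p , e) → resp (≈-sym e) (word Xs p)
      where
      word : ∀ Xs → All P Xs → Words≤ m P (∏ Xs)
      word [] [] = gen ([] , [] , ℕ.z≤n , ≈-refl)
      word (X ∷ Xs) (p ∷ ps) = stable (span-least (preimage-isSubspace (⊗-isLinearʳ {U = S} X) span-isSubspace)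
        (λ (Ys , q , l , e) → gen (X ∷ Ys , p ∷ q , ℕ.s≤s l , ⊗-cong {A = X} ≈-refl e)) (word Xs ps))

    -- The injection `f` of `D` into functions on `U` bounds dimensions by the size of `U`. For
    -- block-diagonal matrices this is n^k, against n^(2k-2) for all matrices.
    module _ {U : Set} ⦃ finU : Finite U ⦄ {P D : Mat S S → Set} {f : V (S × S) → V U} (lin : IsLinear f)
      (D-sub : IsSubspace D) (inj : ∀ {X} → D X → f X ≈ 𝟘 → X ≈ 𝟘) (P⊑D : Generated P ⊑ D) where

      -- The spans of the words of length at most m increase strictly until they are stationary.
      generated-by-short-words : ¬ ¬ (Generated P ⊑ Words≤ (card {U}) P)
      generated-by-short-words k = go (suc (card {U})) λ where
          (inj₁ (i , i≤ , gen⊑)) → k (λ x → words-mono (ℕ.s≤s⁻¹ i≤) (gen⊑ x))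
          (inj₂ (O , orth , O⊂ , len)) → ℕ.<-irrefl len (ℕ.s≤s (orth-length-via f lin orth
            (λ t → inj (span-least D-sub (λ o → P⊑D (forget (All.lookup O⊂ o))) t))))
        where
        forget : ∀ {m} → Words≤ m P ⊑ Generated P
        forget = span-mono (λ (Xs , p , _ , e) → Xs , p , e)
        Stationary Long : ℕ → Set
        Stationary m = ∃ λ i → i ℕ.< m × (Generated P ⊑ Words≤ i P)
        Long m = ∃ λ O → Orth O × All (Words≤ m P) O × length O ≡ m
        -- Taken at one more than the size of `U`, the second alternative exceeds the dimension
        -- bound, and the first provides a stationary length at most that size.
        go : ∀ m → ¬ ¬ (Stationary m ⊎ Long m)
        go zero k = k (inj₂ ([] , tt , [] , refl))
        go (suc m) k = go m λ where
          (inj₁ (i , i< , gen⊑)) → k (inj₁ (i , ℕ.m<n⇒m<1+n i< , gen⊑))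
          (inj₂ (O , orth , O⊂ , len)) → exists-basis span-isSubspace λ (Q , basis) →
            ¬¬-excluded-middle {A = ∃ λ X → Words≤ (suc m) P X × ¬ X ≈ proj Q X} λ where
              (no none) → k (inj₁ (m , ℕ.≤-refl , words-stable m λ {X} x →
                resp (≈-sym (decidable-stable (≈-proj? Q X) (λ ne → none (X , x , ne))))
                  (proj-closed span-isSubspace (Basis.members basis) X)))
              (yes (X , x , ne)) → k (inj₂ (X ⊖ proj Q X ∷ O ,
                ((λ e → ne (⊖≈𝟘⇒≈ e)) , All.map (Basis.residue-⊥ basis X) O⊂ , orth) ,
                IsSubspace.sub span-isSubspace x (words-mono (ℕ.n≤1+n m) (proj-closed span-isSubspace (Basis.members basis) X))
                  ∷ All.map (words-mono (ℕ.n≤1+n m)) O⊂ ,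
                cong suc len))

    module _ (𝒜 : ℕ → Mat S S → Set) (sub : ∀ t → IsSubspace (𝒜 t)) (t : ℕ) (unit : 𝒜 t one) where

      -- A word of length at most 2^(j+1) is cut after 2^j letters, and one multiplication of the
      -- two pieces costs one step of the chain. A piece may be empty, which is where `unit` comes
      -- in.
      words-doubling : ∀ j → (∀ i → i ℕ.< j → ∀ {X Y} → 𝒜 (i ℕ.+ t) X → 𝒜 (i ℕ.+ t) Y → 𝒜 (suc i ℕ.+ t) (X ⊗ Y)) →
        ∀ Xs → All (𝒜 t) Xs → length Xs ℕ.≤ 2 ℕ.^ j → 𝒜 (j ℕ.+ t) (∏ Xs)
      words-doubling zero step [] [] le = unit
      words-doubling zero step (X ∷ []) (p ∷ []) le = IsSubspace.resp (sub t) (≈-sym (⊗-oneʳ X)) p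
      words-doubling zero step (X ∷ Y ∷ Xs) _ (ℕ.s≤s ())
      words-doubling (suc j) step Xs ps le = IsSubspace.resp (sub (suc j ℕ.+ t))
        (subst (λ Zs → ∏ Ys ⊗ ∏ Ys′ ≈ ∏ Zs) (take++drop≡id (2 ℕ.^ j) Xs) (≈-sym (∏-++ Ys Ys′)))
        (step j ℕ.≤-refl
          (words-doubling j step′ Ys (take⁺ (2 ℕ.^ j) ps)
            (ℕ.≤-trans (ℕ.≤-reflexive (length-take (2 ℕ.^ j) Xs)) (ℕ.m⊓n≤m _ _)))
          (words-doubling j step′ Ys′ (drop⁺ (2 ℕ.^ j) ps)
            (ℕ.≤-trans (ℕ.≤-reflexive (length-drop (2 ℕ.^ j) Xs)) (ℕ.≤-trans (ℕ.∸-monoˡ-≤ (2 ℕ.^ j) le)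
              (ℕ.≤-reflexive (trans (ℕ.m+n∸m≡n (2 ℕ.^ j) _) (ℕ.+-identityʳ _)))))))
        where
        Ys Ys′ : List (Mat S S)
        Ys = take (2 ℕ.^ j) Xs
        Ys′ = drop (2 ℕ.^ j) Xs
        step′ : ∀ i → i ℕ.< j → ∀ {X Y} → 𝒜 (i ℕ.+ t) X → 𝒜 (i ℕ.+ t) Y → 𝒜 (suc i ℕ.+ t) (X ⊗ Y)
        step′ i i<j = step i (ℕ.m<n⇒m<1+n i<j)

  -- The permutation rearranges `xs` so that the values of `f` match those of `g` in order; summands
  -- determined by these values then match too.
  ∑-map-↭ : {A B C : Set} (f : A → C) (g : B → C) {xs : List A} {ys : List B} → map f xs ↭ map g ys →
    (h : A → F) (h′ : B → F) → (∀ x y → f x ≡ g y → h x ≡ h′ y) → ∑ xs h ≡ ∑ ys h′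
  ∑-map-↭ f g {xs} {ys} p h h′ agree with zs , eq , q ← ↭-map-inv f p = trans (∑-↭ h q) (pointwise zs ys (sym eq))
    where
    pointwise : ∀ zs ys → map f zs ≡ map g ys → ∑ zs h ≡ ∑ ys h′
    pointwise [] [] e = refl
    pointwise (z ∷ zs) (y ∷ ys) e = cong₂ _+_ (agree z y (proj₁ (∷-injective e))) (pointwise zs ys (proj₂ (∷-injective e)))

  -- The entry of a block-diagonal matrix at ((x , z) , (y , z)) is its value on the tuple x ∷ y ∷ z.
  Index : ℕ → ℕ → Set
  Index n m = Fin n × Vec (Fin n) m

  -- Block-diagonal matrices

  module _ {n m : ℕ} where

    private
      Ix : Set
      Ix = Index n m

    BlockDiagonal : Mat Ix Ix → Set
    BlockDiagonal X = ∀ x z y z′ → ¬ z ≡ z′ → X ((x , z) , (y , z′)) ≡ 0#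

    blockDiagonal-isSubspace : IsSubspace BlockDiagonal
    blockDiagonal-isSubspace = record
      { resp = λ e p x z y z′ ne → trans (sym (e _)) (p x z y z′ ne)
      ; origin = λ _ _ _ _ _ → refl
      ; add = λ p q x z y z′ ne → trans (cong₂ _+_ (p x z y z′ ne) (q x z y z′ ne)) (+-identityˡ 0#)
      ; scale = λ c p x z y z′ ne → trans (cong (c *_) (p x z y z′ ne)) (zeroʳ c)
      }

    ⊗-blockDiagonal : ∀ {X Y : Mat Ix Ix} → BlockDiagonal X → ∀ x z y z′ →
      (X ⊗ Y) ((x , z) , (y , z′)) ≡ ∑ (allFin n) (λ w → X ((x , z) , (w , z)) * Y ((w , z) , (y , z′)))
    ⊗-blockDiagonal {X} {Y} p x z y z′ = trans (∑-cartesianProduct (allFin n) (elems {Vec (Fin n) m}) _)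
      (∑-cong (allFin n) (λ w → ∑-supported z _ (λ u z≢u → trans (cong (_* Y _) (p x z w u z≢u)) (zeroˡ _))))

    blockDiagonal-⊗ : ∀ {X Y : Mat Ix Ix} → BlockDiagonal X → BlockDiagonal Y → BlockDiagonal (X ⊗ Y)
    blockDiagonal-⊗ {X} {Y} p q x z y z′ ne = trans (⊗-blockDiagonal {X} {Y} p x z y z′)
      (∑-0 (allFin n) (All.universal (λ w → trans (cong (X _ *_) (q w z y z′ ne)) (zeroʳ _)) (allFin n)))

    blockDiagonal-one : BlockDiagonal one
    blockDiagonal-one x z y z′ ne = δ-diff {s = x , z} {t = y , z′} (λ e → ne (cong proj₂ e))

    blocks : Mat Ix Ix → V (Fin n × Ix)
    blocks X (x , (y , z)) = X ((x , z) , (y , z))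

    blocks-isLinear : IsLinear blocks
    blocks-isLinear = record { f-cong = λ e _ → e _ ; f-⊕ = λ _ _ _ → refl ; f-· = λ _ _ _ → refl }

    blocks-injective : ∀ {X} → BlockDiagonal X → blocks X ≈ 𝟘 → X ≈ 𝟘
    blocks-injective p e ((x , z) , (y , z′)) with Vec.≡-dec Fin._≟_ z z′
    ... | yes refl = e (x , (y , z))
    ... | no ne = p x z y z′ ne

  -- Matrices that are constant on colour classes

  module _ {n m : ℕ} {C : Set} where

    private
      Ix : Set
      Ix = Index n m

    Measurable : Coloring n (suc (suc m)) C → Mat Ix Ix → Set
    Measurable χ X = BlockDiagonal X ×
      (∀ x y z x′ y′ z′ → χ (x ∷ y ∷ z) ≡ χ (x′ ∷ y′ ∷ z′) → X ((x , z) , (y , z)) ≡ X ((x′ , z′) , (y′ , z′)))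

    measurable-isSubspace : ∀ χ → IsSubspace (Measurable χ)
    measurable-isSubspace χ = record
      { resp = λ e (p , q) → BD.resp e p , λ x y z x′ y′ z′ c → trans (sym (e _)) (trans (q x y z x′ y′ z′ c) (e _))
      ; origin = BD.origin , λ _ _ _ _ _ _ _ → refl
      ; add = λ (p , q) (p′ , q′) → BD.add p p′ , λ x y z x′ y′ z′ c → cong₂ _+_ (q x y z x′ y′ z′ c) (q′ x y z x′ y′ z′ c)
      ; scale = λ a (p , q) → BD.scale a p , λ x y z x′ y′ z′ c → cong (a *_) (q x y z x′ y′ z′ c)
      }
      where module BD = IsSubspace blockDiagonal-isSubspace

    -- The entry of `one` at x ∷ y ∷ z only records whether x = y.
    measurable-unit : ∀ {χ} → CompatibleWithEquality χ → Measurable χ one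
    measurable-unit {χ} compat = blockDiagonal-one , colour
      where
      colour : ∀ x y z x′ y′ z′ → χ (x ∷ y ∷ z) ≡ χ (x′ ∷ y′ ∷ z′) → one ((x , z) , (y , z)) ≡ one ((x′ , z′) , (y′ , z′))
      colour x y z x′ y′ z′ c = by-cases (x Fin.≟ y)
        where
        equalities : (x ≡ y → x′ ≡ y′) × (x′ ≡ y′ → x ≡ y)
        equalities = compat (x ∷ y ∷ z) (x′ ∷ y′ ∷ z′) c Fin.zero (Fin.suc Fin.zero)
        diagonal : ∀ {a b : Fin n} {u : Vec (Fin n) m} → a ≡ b → δ (a , u) (b , u) ≡ 1#
        diagonal {a} {u = u} refl = δ-same (a , u)
        off-diagonal : ∀ {a b : Fin n} {u : Vec (Fin n) m} → ¬ a ≡ b → δ (a , u) (b , u) ≡ 0#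
        off-diagonal a≢b = δ-diff (λ e → a≢b (cong proj₁ e))
        by-cases : Dec (x ≡ y) → δ (x , z) (y , z) ≡ δ (x′ , z′) (y′ , z′)
        by-cases (yes e) = trans (diagonal e) (sym (diagonal (proj₁ equalities e)))
        by-cases (no ne) = trans (off-diagonal ne) (sym (off-diagonal (λ e → ne (proj₂ equalities e))))

    -- Transposition exchanges the first two entries of the tuple, which is a shuffle.
    measurable-star : ∀ {χ} → Shufflable χ → ∀ {X} → Measurable χ X → Measurable χ (X ᵀ)
    measurable-star {χ} shuf (p , q) = (λ x z y z′ ne → p y z′ x z (λ e → ne (sym e))) ,
      λ x y z x′ y′ z′ c → q y x z y′ x′ z′
        (trans (cong χ (sym (swapped x y z))) (trans (shuf π _ _ c) (cong χ (swapped x′ y′ z′))))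
      where
      π : Fin (suc (suc m)) → Fin (suc (suc m))
      π Fin.zero = Fin.suc Fin.zero
      π (Fin.suc Fin.zero) = Fin.zero
      π (Fin.suc (Fin.suc i)) = Fin.suc (Fin.suc i)
      swapped : ∀ x y z → shuffle {C = C} π (x ∷ y ∷ z) ≡ y ∷ x ∷ z
      swapped x y z = cong (λ u → y ∷ x ∷ u) (Vec.tabulate∘lookup z)

    measurable-mono : ∀ {χ χ′ : Coloring n (suc (suc m)) C} → χ′ ⪯ χ → Measurable χ ⊑ Measurable χ′
    measurable-mono ref (p , q) = p , λ x y z x′ y′ z′ c → q x y z x′ y′ z′ (ref _ _ c)

    -- The entry of the product at v = x ∷ y ∷ z sums X at v[w/2] times Y at v[w/1] over w. The
    -- colours of these two tuples occur together in the vector that w contributes to the refinement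
    -- multiset, so equal multisets give equal sums.
    measurable-⊗ : ∀ {χ χ′ : Coloring n (suc (suc m)) C} → RefinesWL χ′ χ → ∀ {X Y : Mat Ix Ix} →
      Measurable χ X → Measurable χ Y → Measurable χ′ (X ⊗ Y)
    measurable-⊗ {χ} {χ′} ref {X} {Y} (p , q) (p′ , q′) = blockDiagonal-⊗ p p′ , λ x y z x′ y′ z′ c → begin
      (X ⊗ Y) ((x , z) , (y , z))                                                  ≡⟨ ⊗-blockDiagonal {X = X} {Y} p x z y z ⟩
      ∑ (allFin n) (λ w → X ((x , z) , (w , z)) * Y ((w , z) , (y , z)))
        ≡⟨ ∑-map-↭ _ _ (proj₂ (ref _ _ c)) _ _ (λ w w′ e → cong₂ _*_
             (q x w z x′ w′ z′ (Vec.∷-injectiveˡ (Vec.∷-injectiveʳ e)))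
             (q′ w y z w′ y′ z′ (Vec.∷-injectiveˡ e))) ⟩
      ∑ (allFin n) (λ w → X ((x′ , z′) , (w , z′)) * Y ((w , z′) , (y′ , z′)))     ≡⟨ ⊗-blockDiagonal {X = X} {Y} p x′ z′ y′ z′ ⟨
      (X ⊗ Y) ((x′ , z′) , (y′ , z′))                                              ∎

    generated-blockDiagonal : ∀ {χ} → Generated (Measurable χ) ⊑ BlockDiagonal
    generated-blockDiagonal {χ} = span-least blockDiagonal-isSubspace λ (Xs , p , e) →
      IsSubspace.resp blockDiagonal-isSubspace (≈-sym e) (word Xs p)
      where
      word : ∀ Xs → All (Measurable χ) Xs → BlockDiagonal (∏ Xs)
      word [] [] = blockDiagonal-one
      word (X ∷ Xs) (p ∷ ps) = blockDiagonal-⊗ (proj₁ p) (word Xs ps)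

    -- The indicator of a class of `χ′` is measurable for `χ′`; were it always measurable for `χ`,
    -- equal `χ`-colours would force equal `χ′`-colours. Defining it requires deciding equality of
    -- `χ′`-colours, which for finitely many pairs is available under a double negation.
    measurable-strict : ∀ {χ χ′ : Coloring n (suc (suc m)) C} → χ′ ≺ χ → ¬ (Measurable χ′ ⊑ Measurable χ)
    measurable-strict {χ} {χ′} (ref , χ′≢χ) ⊑ = decide λ dec → χ′≢χ (ref , λ v w e → coarser dec v w e)
      where
      Tup : Set
      Tup = Tuple n (suc (suc m))
      ¬¬-all : {A : Set} {P : A → Set} (xs : List A) → (∀ x → ¬ ¬ P x) → ¬ ¬ All P xs
      ¬¬-all [] h k = k []
      ¬¬-all (x ∷ xs) h k = h x λ p → ¬¬-all xs h λ ps → k (p ∷ ps)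
      decide : ¬ ¬ (∀ v w → Dec (χ′ v ≡ χ′ w))
      decide k = ¬¬-all {P = λ (v , w) → Dec (χ′ v ≡ χ′ w)} (elems {Tup × Tup}) (λ _ → ¬¬-excluded-middle)
        λ all → k (λ v w → All.lookup all (Finite.complete (finite-× {Tup} {Tup}) (v , w)))
      coarser : (∀ v w → Dec (χ′ v ≡ χ′ w)) → ∀ v w → χ v ≡ χ w → χ′ v ≡ χ′ w
      coarser dec v@(x ∷ y ∷ z) w@(x′ ∷ y′ ∷ z′) e = recover (dec v w) (begin
        value (dec v w)                       ≡⟨ on-diagonal x′ y′ z′ ⟨
        indicator ((x′ , z′) , (y′ , z′))     ≡⟨ proj₂ (⊑ indicator∈) x y z x′ y′ z′ e ⟨
        indicator ((x , z) , (y , z))         ≡⟨ on-diagonal x y z ⟩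
        value (dec v v)                       ≡⟨ value-yes (dec v v) refl ⟩
        1#                                    ∎)
        where
        value : {P : Set} → Dec P → F
        value (yes _) = 1#
        value (no _) = 0#
        value-yes : {P : Set} (d : Dec P) → P → value d ≡ 1#
        value-yes (yes _) _ = refl
        value-yes (no ¬p) p = ⊥-elim (¬p p)
        value-cong : {P Q : Set} (d : Dec P) (d′ : Dec Q) → (P → Q) → (Q → P) → value d ≡ value d′
        value-cong (yes p) d′ f g = sym (value-yes d′ (f p))
        value-cong (no ¬p) (yes q) f g = ⊥-elim (¬p (g q))
        value-cong (no ¬p) (no ¬q) f g = refl
        recover : {P : Set} (d : Dec P) → value d ≡ 1# → P
        recover (yes p) _ = p
        recover (no _) 0≡1 = ⊥-elim (1≢0 (sym 0≡1))
        indicator : Mat Ix Ix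
        indicator ((a , u) , (b , u′)) = δ u u′ * value (dec v (a ∷ b ∷ u))
        on-diagonal : ∀ a b u → indicator ((a , u) , (b , u)) ≡ value (dec v (a ∷ b ∷ u))
        on-diagonal a b u = trans (cong (_* value (dec v (a ∷ b ∷ u))) (δ-same u)) (*-identityˡ _)
        indicator∈ : Measurable χ′ indicator
        indicator∈ = (λ a u b u′ ne → trans (cong (_* _) (δ-diff ne)) (zeroˡ _)) ,
          λ a b u a′ b′ u′ c → trans (on-diagonal a b u) (trans
            (value-cong (dec v _) (dec v _) (λ p → trans p c) (λ p → trans p (sym c)))
            (sym (on-diagonal a′ b′ u′)))

  -- The bound on the number of iterations

  card-Index : ∀ n m → card {Index n m} ≡ n ℕ.^ suc m
  card-Index n m = trans (card-× {Fin n} {Vec (Fin n) m}) (cong₂ ℕ._*_ (card-Fin n) (card-Vec n m))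

  module _ {n m ℓ : ℕ} {C : Set} (χ : ℕ → Coloring (suc n) (suc (suc m)) C)
    (regular : ∀ t → t ℕ.≤ ℓ → Shufflable (χ t) × CompatibleWithEquality (χ t))
    (refines : ∀ t → suc t ℕ.≤ ℓ → RefinesWL (χ (suc t)) (χ t))
    (strict : ∀ t → suc t ℕ.≤ ℓ → χ (suc t) ≺ χ t) where

    private
      S : Set
      S = Index (suc n) m
      𝒜 : ℕ → Mat S S → Set
      𝒜 t = Measurable (χ t)
      D j : ℕ
      D = suc n ℕ.^ suc (suc m)
      j = ⌈log₂ D ⌉

    measurable-grow : ∀ i t → i ℕ.+ t ℕ.≤ ℓ → 𝒜 t ⊑ 𝒜 (i ℕ.+ t)
    measurable-grow zero t le p = p
    measurable-grow (suc i) t le p = measurable-mono (proj₁ (strict (i ℕ.+ t) le)) (measurable-grow i t (ℕ.<⇒≤ le) p)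

    generated-bounded : ∀ t → j ℕ.+ t ℕ.≤ ℓ → ¬ ¬ (Generated (𝒜 t) ⊑ 𝒜 (j ℕ.+ t))
    generated-bounded t le k = generated-by-short-words {P = 𝒜 t} blocks-isLinear blockDiagonal-isSubspace
      blocks-injective (generated-blockDiagonal {χ = χ t}) λ short → k λ x →
        span-least (measurable-isSubspace (χ (j ℕ.+ t))) (λ (Xs , p , len , e) →
          IsSubspace.resp (measurable-isSubspace (χ (j ℕ.+ t))) (≈-sym e)
            (words-doubling 𝒜 (λ t → measurable-isSubspace (χ t)) t
              (measurable-unit (proj₂ (regular t (ℕ.≤-trans (ℕ.m≤n+m t j) le))))
              j (λ i i<j → measurable-⊗ (refines (i ℕ.+ t) (ℕ.≤-trans (ℕ.+-monoˡ-≤ t i<j) le)))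
              Xs p (ℕ.≤-trans len (ℕ.≤-trans (ℕ.≤-reflexive card≡D) (n≤2^⌈log₂n⌉ D)))))
          (short x)
      where
      card≡D : card {Fin (suc n) × S} ≡ D
      card≡D = trans (card-× {Fin (suc n)} {S}) (cong₂ ℕ._*_ (card-Fin (suc n)) (card-Index (suc n) m))

    -- After `j` steps everything generated by `𝒜 t` has become measurable, and step suc j is a
    -- strict refinement, so it makes a new matrix measurable. Hence the sampling period suc j.
    generated-strict : ∀ t → suc j ℕ.+ t ℕ.≤ ℓ → ¬ (Generated (𝒜 (suc j ℕ.+ t)) ⊑ Generated (𝒜 t))
    generated-strict t le back = generated-bounded t (ℕ.<⇒≤ le) λ bounded →
      measurable-strict (strict (j ℕ.+ t) le) (λ p → bounded (back (⊑-generated p)))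

    chain-bound : ∀ q → q ℕ.* suc j ℕ.≤ ℓ → q ℕ.< 2 ℕ.* suc n ℕ.^ suc m
    chain-bound q le = subst (λ N → q ℕ.< 2 ℕ.* N) (card-Index (suc n) m)
      (chain-length (λ i → Generated (𝒜 (i ℕ.* suc j))) q (Fin.zero , Vec.replicate m Fin.zero)
        (λ i i≤q → generated-isStarAlgebra (measurable-star (proj₁ (regular _ (within i≤q)))))
        (λ i i<q → generated-mono (measurable-grow (suc j) (i ℕ.* suc j) (within i<q)))
        (λ i i<q → generated-strict (i ℕ.* suc j) (within i<q)))
      where
      within : ∀ {i} → i ℕ.≤ q → i ℕ.* suc j ℕ.≤ ℓ
      within i≤q = ℕ.≤-trans (ℕ.*-monoˡ-≤ (suc j) i≤q) le

    iteration-bound : ℓ ℕ.≤ 2 ℕ.* suc n ℕ.^ suc m ℕ.* (j ℕ.+ 1)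
    -- If ℓ exceeded the bound, there would be room for a chain of 2N sampled steps, with N the
    -- matrix size, whereas `chain-bound` allows fewer than 2N.
    iteration-bound = ℕ.≮⇒≥ λ lt → ℕ.<-irrefl refl (chain-bound (2 ℕ.* suc n ℕ.^ suc m)
      (ℕ.<⇒≤ (subst (λ s → 2 ℕ.* suc n ℕ.^ suc m ℕ.* s ℕ.< ℓ) (ℕ.+-comm j 1) lt)))

-- The rational numbers as an ordered field, with the convention that 0 has inverse 0

invert : (p : ℚ) → Dec (p ≡ 0ℚ) → ℚ
invert p (yes _) = 0ℚ
invert p (no p≢0) = ℚ.1/_ p ⦃ ℚ.≢-nonZero p≢0 ⦄

invert-inverseʳ : ∀ p (d : Dec (p ≡ 0ℚ)) → ¬ p ≡ 0ℚ → p ℚ.* invert p d ≡ 1ℚ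
invert-inverseʳ p (yes p≡0) p≢0 = ⊥-elim (p≢0 p≡0)
invert-inverseʳ p (no p≢0) _ = ℚ.*-inverseʳ p ⦃ ℚ.≢-nonZero p≢0 ⦄

square-nonNegative : ∀ p → 0ℚ ℚ.≤ p ℚ.* p
square-nonNegative p with ℚ.≤-total 0ℚ p
... | inj₁ 0≤p = ℚ.nonNegative⁻¹ _ ⦃ ℚ.nonNeg*nonNeg⇒nonNeg p ⦃ ℚ.nonNegative 0≤p ⦄ p ⦃ ℚ.nonNegative 0≤p ⦄ ⦄
... | inj₂ p≤0 = ℚ.nonNegative⁻¹ _ ⦃ ℚ.nonPos*nonPos⇒nonPos p ⦃ ℚ.nonPositive p≤0 ⦄ p ⦃ ℚ.nonPositive p≤0 ⦄ ⦄

ℚ-orderedField : OrderedField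
ℚ-orderedField = record
  { F = ℚ
  ; _+_ = ℚ._+_
  ; _*_ = ℚ._*_
  ; -_ = ℚ.-_
  ; _⁻¹ = λ p → invert p (p ℚ.≟ 0ℚ)
  ; 0# = 0ℚ
  ; 1# = 1ℚ
  ; isCommutativeRing = ℚ.+-*-isCommutativeRing
  ; _≟_ = ℚ._≟_
  ; *-inverseʳ = λ p → invert-inverseʳ p (p ℚ.≟ 0ℚ)
  ; 1≢0 = λ ()
  ; NonNeg = 0ℚ ℚ.≤_
  ; nonNeg-+ = ℚ.+-mono-≤
  ; nonNeg-square = square-nonNegative
  ; nonNeg-antisym = λ {p} 0≤p 0≤-p → ℚ.≤-antisym
      (subst₂ ℚ._≤_ (ℚ.+-identityʳ p) (ℚ.+-inverseʳ p) (ℚ.+-monoʳ-≤ p 0≤-p)) 0≤p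
  }

open import Data.Nat using (ℕ; suc; _+_; _*_; _∸_; _^_; _≤_)
open import Data.Nat.Logarithm using (⌈log₂_⌉)
open import Data.Product using (_×_)

theorem3p2 : (k n ℓ : ℕ) → 2 ≤ k → (C : Set) → (χ : ℕ → Coloring n k C)
    → (∀ t → t ≤ ℓ → Shufflable (χ t) × CompatibleWithEquality (χ t))
    → (∀ t → 1 ≤ t → t ≤ ℓ → RefinesWL (χ t) (χ (t ∸ 1)))
    → (∀ t → 1 ≤ t → t ≤ ℓ → χ t ≺ χ (t ∸ 1))
    → ℓ ≤ 2 * n ^ (k ∸ 1) * (⌈log₂ (n ^ k) ⌉ + 1)
theorem3p2 (suc zero) _ _ (ℕ.s≤s ())
theorem3p2 (suc (suc m)) n zero _ C χ regular refines strict = ℕ.z≤n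
-- Over an empty vertex set there are no tuples, so all colourings are equivalent and the first
-- refinement cannot be strict.
theorem3p2 (suc (suc m)) zero (suc ℓ) _ C χ regular refines strict =
  ⊥-elim (proj₂ (strict 1 (ℕ.s≤s ℕ.z≤n) (ℕ.s≤s ℕ.z≤n)) ((λ { (() ∷ _) }) , (λ { (() ∷ _) })))
theorem3p2 (suc (suc m)) (suc n) ℓ@(suc _) _ C χ regular refines strict =
  iteration-bound ℚ-orderedField χ regular (λ t → refines (suc t) (ℕ.s≤s ℕ.z≤n)) (λ t → strict (suc t) (ℕ.s≤s ℕ.z≤n))
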